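{- $\mathsf{DNR}_k\blacktriangledown\mathsf{DNR}_k<^1_1\mathsf{DNR}_{k^2}$ for any $k\ge2$.
   Context: $\mathsf{DNR}_k$ is the set of all $k$-valued diagonally noncomputable functions, i.e. all total $f:\mathbb N\to\mathbb N$ with $f(n)<k$ for every $n$ and $f(e)\neq\Phi_e(e)$ whenever $\Phi_e(e)$ converges, where $\Phi_e$ is the $e$-th partial computable function on $\mathbb N$. It is a $\Pi^0_1$ subset of $k^{\mathbb N}=\{0,\dots,k-1\}^{\mathbb N}$. For $A,B\subseteq\mathbb N^{\mathbb N}$, $A\le^1_1B$ (Medvedev reducibility) means that there is a partial computable function $\Gamma:\subseteq\mathbb N^{\mathbb N}\to\mathbb N^{\mathbb N}$ defined on all of $B$ with $\Gamma(g)\in A$ for every $g\in B$; $A<^1_1B$ means $A\le^1_1B$ and $B\not\le^1_1A$. With each $\Pi^0_1$ set $P\subseteq k^{\mathbb N}$ (given by an index) a corresponding computable tree $T_P\subseteq k^{<\mathbb N}$ whose set of infinite paths is $P$ is fixed; $L_P$ is the set of leaves (dead ends) of $T_P$. The hyperconcatenation $Q\blacktriangledown P$ is the iterated concatenation of copies of $P$ along the tree $T_Q$: it is the set of infinite paths of the tree of all initial segments of strings of the form $$\rho_0{}^\frown\langle\tau(0)\rangle^\frown\rho_1{}^\frown\langle\tau(1)\rangle^\frown\cdots{}^\frown\rho_{n-1}{}^\frown\langle\tau(n-1)\rangle^\frown\sigma,$$ where $\tau\in T_Q$, $n=|\tau|$, $\rho_0,\dots,\rho_{n-1}\in L_P$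 and $\sigma\in T_P$. -}

module Defs where

open import Data.List using (List; []; _∷_; _++_; _∷ʳ_; map; concatMap; applyUpTo)
open import Data.List.Relation.Binary.Prefix.Heterogeneous using (Prefix)
open import Data.List.Relation.Unary.All using (All)
open import Data.Nat using (ℕ; zero; suc; _+_; _<_)
open import Data.Product using (∃; ∃₂; _×_; proj₁; proj₂; uncurry)
open import Data.Sum using (_⊎_)
open import Level using (0ℓ)
open import Relation.Binary.PropositionalEquality using (_≡_; _≢_)
open import Relation.Nullary using (¬_)
open import Relation.Unary using (Pred; _∈_; _∉_; _⊆_; _≐_)

Baire : Set
Baire = ℕ → ℕ

-- Cantor's pairing bijection ℕ × ℕ → ℕ.

triangle : ℕ → ℕ
triangle zero    = zero
triangle (suc n) = suc n + triangle n

⟨_,_⟩ : ℕ → ℕ → ℕ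
⟨ x , y ⟩ = triangle (x + y) + y

-- Partial recursive functions relative to an oracle, presented as unary
-- functions: several arguments are passed as one Cantor pair.

data Code : Set where
  zeroᶜ succᶜ leftᶜ rightᶜ oracleᶜ : Code
  pairᶜ compᶜ precᶜ                : Code → Code → Code
  muᶜ                              : Code → Code

-- g ⊢ c · n ⇓ v : with oracle g, the program c halts on input n with
-- output v.

infix 4 _⊢_·_⇓_

data _⊢_·_⇓_ (g : Baire) : Code → ℕ → ℕ → Set where
  zero⇓   : ∀ {n} → g ⊢ zeroᶜ · n ⇓ 0
  succ⇓   : ∀ {n} → g ⊢ succᶜ · n ⇓ suc n
  left⇓   : ∀ {x y} → g ⊢ leftᶜ · ⟨ x , y ⟩ ⇓ x
  right⇓  : ∀ {x y} → g ⊢ rightᶜ · ⟨ x , y ⟩ ⇓ y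
  oracle⇓ : ∀ {n} → g ⊢ oracleᶜ · n ⇓ g n
  pair⇓   : ∀ {c d n u v} →
            g ⊢ c · n ⇓ u → g ⊢ d · n ⇓ v → g ⊢ pairᶜ c d · n ⇓ ⟨ u , v ⟩
  comp⇓   : ∀ {c d n u v} →
            g ⊢ d · n ⇓ u → g ⊢ c · u ⇓ v → g ⊢ compᶜ c d · n ⇓ v
  prec⇓₀  : ∀ {c d x v} →
            g ⊢ c · x ⇓ v → g ⊢ precᶜ c d · ⟨ x , 0 ⟩ ⇓ v
  prec⇓₊  : ∀ {c d x n u v} →
            g ⊢ precᶜ c d · ⟨ x , n ⟩ ⇓ u → g ⊢ d · ⟨ x , ⟨ n , u ⟩ ⟩ ⇓ v →
            g ⊢ precᶜ c d · ⟨ x , suc n ⟩ ⇓ v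
  mu⇓     : ∀ {c x n} →
            (∀ m → m < n → ∃ λ v → g ⊢ c · ⟨ x , m ⟩ ⇓ suc v) →
            g ⊢ c · ⟨ x , n ⟩ ⇓ 0 → g ⊢ muᶜ c · x ⇓ n

encode : Code → ℕ
encode zeroᶜ       = ⟨ 0 , 0 ⟩
encode succᶜ       = ⟨ 1 , 0 ⟩
encode leftᶜ       = ⟨ 2 , 0 ⟩
encode rightᶜ      = ⟨ 3 , 0 ⟩
encode oracleᶜ     = ⟨ 4 , 0 ⟩
encode (pairᶜ c d) = ⟨ 5 , ⟨ encode c , encode d ⟩ ⟩
encode (compᶜ c d) = ⟨ 6 , ⟨ encode c , encode d ⟩ ⟩
encode (precᶜ c d) = ⟨ 7 , ⟨ encode c , encode d ⟩ ⟩
encode (muᶜ c)     = ⟨ 8 , encode c ⟩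

-- The partial computable functions are those computable from the constant
-- zero oracle.

infix 4 _·_⇓_

_·_⇓_ : Code → ℕ → ℕ → Set
c · n ⇓ v = (λ _ → 0) ⊢ c · n ⇓ v

-- The graph of Φₑ: Φ e n v says that Φₑ(n) converges to v.  As encode is
-- injective, this is single-valued; Φₑ is nowhere defined if e is not the
-- number of a program.

Φ : ℕ → ℕ → ℕ → Set
Φ e n v = ∃ λ c → encode c ≡ e × c · n ⇓ v

DNR : ℕ → Pred Baire 0ℓ
DNR k f = (∀ n → f n < k) × (∀ e v → Φ e e v → f e ≢ v)

-- A program c is regarded as the partial functional sending g to the
-- function n ↦ (output of c on n with oracle g), with domain the set of
-- those g for which this function is total.

infix 4 _⟦_⟧≔_ _≤¹₁_ _<¹₁_

_⟦_⟧≔_ : Code → Baire → Baire → Set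
c ⟦ g ⟧≔ h = ∀ n → g ⊢ c · n ⇓ h n

_≤¹₁_ : Pred Baire 0ℓ → Pred Baire 0ℓ → Set
A ≤¹₁ B = ∃ λ c → ∀ g → g ∈ B → ∃ λ h → c ⟦ g ⟧≔ h × h ∈ A

_<¹₁_ : Pred Baire 0ℓ → Pred Baire 0ℓ → Set
A <¹₁ B = A ≤¹₁ B × ¬ (B ≤¹₁ A)

Str : Set
Str = List ℕ

encodeStr : Str → ℕ
encodeStr []      = 0
encodeStr (a ∷ σ) = suc ⟨ a , encodeStr σ ⟩

ComputableSet : Pred Str 0ℓ → Set
ComputableSet S =
  ∃ λ c → ∀ σ → (σ ∈ S × c · encodeStr σ ⇓ 1) ⊎ (σ ∉ S × c · encodeStr σ ⇓ 0)

infix 4 _⊑_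

_⊑_ : Str → Str → Set
_⊑_ = Prefix _≡_

Paths : Pred Str 0ℓ → Pred Baire 0ℓ
Paths S x = ∀ n → applyUpTo x n ∈ S

Leaves : Pred Str 0ℓ → Pred Str 0ℓ
Leaves S ρ = ρ ∈ S × (∀ a → ρ ∷ʳ a ∉ S)

-- A computable tree in k^{<ℕ} whose set of infinite paths is P.

record TreeFor (k : ℕ) (P : Pred Baire 0ℓ) : Set₁ where
  field
    T            : Pred Str 0ℓ
    bounded      : T ⊆ All (_< k)
    prefixClosed : ∀ {σ τ} → σ ⊑ τ → τ ∈ T → σ ∈ T
    computable   : ComputableSet T
    paths        : Paths T ≐ P

open TreeFor public using (T)

-- A list of pairs (ρᵢ , τ(i)) represents ρ₀⌢⟨τ(0)⟩⌢ρ₁⌢⟨τ(1)⟩⌢⋯.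

flatten : List (Str × ℕ) → Str
flatten = concatMap (uncurry _∷ʳ_)

HyperTree : (TQ TP : Pred Str 0ℓ) → Pred Str 0ℓ
HyperTree TQ TP s =
  ∃₂ λ (blocks : List (Str × ℕ)) (σ : Str) →
    map proj₂ blocks ∈ TQ
    × All (Leaves TP) (map proj₁ blocks)
    × σ ∈ TP
    × s ⊑ flatten blocks ++ σ

-- Hyperconcatenation depends on the trees, not only on Q and P.

infixr 6 _▼_

_▼_ : ∀ {k P Q} → TreeFor k Q → TreeFor k P → Pred Baire 0ℓ
TQ ▼ TP = Paths (HyperTree (T TQ) (T TP))

{-# OPTIONS --safe #-}
module Submission where

-- Reduction.  For g ∈ DNR (k ^ 2) read g at a number of the program pairing
-- Φ_d(d) with Φₑ(e) as a pair (u , v) below k: then u ≠ Φ_d(d) or v ≠ Φₑ(e).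
-- Follow e ↦ v(d , e) through the tree.  If it ever leaves the tree, then
-- v(d , e) = Φₑ(e) for some e, so that u(d , e) is a safe value at d: go up to
-- a leaf, output u(d , e), and start over with d + 1.  A suitable e is found
-- with the tree instead of a universal machine: by König's lemma, Φₑ(e) = v
-- iff for some n ≥ e no string of the tree longer than n has value v at e.
--
-- Strictness.  Every σ in the tree lies below a leaf, for otherwise one could
-- compute diagonally noncomputable values above σ.  After the leaf a fresh
-- block may start, so every σ in the tree, extendible or not, extends to an
-- element of D ▼ D.  Hence if c reduced any DNR m to D ▼ D, the first σ in the
-- tree on which c converges at n would give a computable value that c takes at
-- n on some element of D ▼ D; with n an index of this function, it is Φₙ(n).

open import Defs
open import Axiom.ExcludedMiddle using (ExcludedMiddle)
open import Data.Nat using (ℕ; zero; suc; pred; _+_; _*_; _∸_; _^_; _⊔_; _≤_; _<_; z≤n; s≤s; s≤s⁻¹; ≢-nonZero)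
open import Data.Nat.Induction using (<-rec)
open import Data.Nat.Properties
open import Data.List using (List; []; _∷_; _++_; _∷ʳ_; [_]; map; length; drop; replicate; applyUpTo; _ʳ++_)
open import Data.List.Properties using
  (ʳ++-defn; reverse-involutive; applyUpTo-∷ʳ; length-applyUpTo; ++-identityʳ; ++-assoc; length-++; map-++; concatMap-++)
open import Data.List.Relation.Binary.Prefix.Heterogeneous using ([]; _∷_)
open import Data.List.Relation.Unary.All as All using (All; []; _∷_)
import Data.List.Relation.Unary.All.Properties as All
open import Data.Product using (∃; _×_; _,_; proj₁; proj₂; uncurry)
open import Data.Empty using (⊥)
open import Data.Unit using (⊤; tt)
open import Data.Sum using (inj₁; inj₂)
open import Relation.Binary.Definitions using (tri<; tri≈; tri>)
open import Function using (_∘_; case_of_)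
open import Level using (0ℓ)
open import Relation.Binary.PropositionalEquality using (_≡_; _≢_; refl; sym; trans; cong; cong₂; subst; module ≡-Reasoning)
open import Relation.Unary using (Pred; _∈_; _∉_; _⊆_)
open import Relation.Nullary.Decidable using (decidable-stable)
open import Relation.Nullary using (¬_; yes; no; contradiction)

private variable
  g : Baire

-- The Cantor pairing

-- The successor in the enumeration along antidiagonals; iterating it inverts the pairing without
-- division or square roots.
next : ℕ × ℕ → ℕ × ℕ
next (zero  , y) = suc y , 0
next (suc x , y) = x , suc y

unpair : ℕ → ℕ × ℕ
unpair zero    = 0 , 0
unpair (suc n) = next (unpair n)

pair-next : ∀ p → ⟨ proj₁ (next p) , proj₂ (next p) ⟩ ≡ suc ⟨ proj₁ p , proj₂ p ⟩
pair-next (zero  , y) rewrite +-identityʳ y | +-identityʳ (y + triangle y) | +-comm y (triangle y) = refl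
pair-next (suc x , y) rewrite +-suc x y = +-suc _ y

pair-unpair : ∀ n → ⟨ proj₁ (unpair n) , proj₂ (unpair n) ⟩ ≡ n
pair-unpair zero    = refl
pair-unpair (suc n) = trans (pair-next (unpair n)) (cong suc (pair-unpair n))

unpair-pair : ∀ x y → unpair ⟨ x , y ⟩ ≡ (x , y)
unpair-pair x y = diagonal (x + y) x y refl
  where
  -- Induction on the antidiagonal and then on `y`: a diagonal begins right after the last pair
  -- `(0 , x)` of the previous one.
  diagonal : ∀ s x y → x + y ≡ s → unpair ⟨ x , y ⟩ ≡ (x , y)
  diagonal zero    zero    zero    p  = refl
  diagonal (suc s) (suc x) zero    p = trans (cong unpair (pair-next (zero , x)))
    (cong next (diagonal s zero x (suc-injective (trans (cong suc (sym (+-identityʳ x))) p))))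
  diagonal s       x       (suc y) p = trans (cong unpair (pair-next (suc x , y)))
    (cong next (diagonal s (suc x) y (trans (sym (+-suc x y)) p)))

pair-injective : ∀ {x y x′ y′} → ⟨ x , y ⟩ ≡ ⟨ x′ , y′ ⟩ → x ≡ x′ × y ≡ y′
pair-injective {x} {y} {x′} {y′} p with trans (sym (unpair-pair x y)) (trans (cong unpair p) (unpair-pair x′ y′))
... | refl = refl , refl

triangle-mono : ∀ {m n} → m ≤ n → triangle m ≤ triangle n
triangle-mono z≤n     = z≤n
triangle-mono (s≤s p) = +-mono-≤ (s≤s p) (triangle-mono p)

pair-mono : ∀ {x y x′ y′} → x ≤ x′ → y ≤ y′ → ⟨ x , y ⟩ ≤ ⟨ x′ , y′ ⟩
pair-mono p q = +-mono-≤ (triangle-mono (+-mono-≤ p q)) q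

y≤⟨x,y⟩ : ∀ x y → y ≤ ⟨ x , y ⟩
y≤⟨x,y⟩ x y = m≤n+m y (triangle (x + y))

-- Programs

build : ℕ → Code → Code → Code → Code
build 0 _ _ _ = zeroᶜ
build 1 _ _ _ = succᶜ
build 2 _ _ _ = leftᶜ
build 3 _ _ _ = rightᶜ
build 4 _ _ _ = oracleᶜ
build 5 c d _ = pairᶜ c d
build 6 c d _ = compᶜ c d
build 7 c d _ = precᶜ c d
build _ _ _ b = muᶜ b

-- Serves to show that `encode` is injective. Numbers of no program decode to arbitrary programs,
-- and the fuel, which has to reach the height of the program, replaces an argument for termination.
decode : (fuel : ℕ) → ℕ → Code
decode zero    n = zeroᶜ
decode (suc f) n =
  let t , p = unpair n
      l , r = unpair p
  in build t (decode f l) (decode f r) (decode f p)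

decode-pair : ∀ f t p → decode (suc f) ⟨ t , p ⟩ ≡
              build t (decode f (proj₁ (unpair p))) (decode f (proj₂ (unpair p))) (decode f p)
decode-pair f t p rewrite unpair-pair t p = refl

height : Code → ℕ
height (pairᶜ c d) = suc (height c ⊔ height d)
height (compᶜ c d) = suc (height c ⊔ height d)
height (precᶜ c d) = suc (height c ⊔ height d)
height (muᶜ c)     = suc (height c)
height _           = 1

decode-encode : ∀ {f} c → height c ≤ f → decode f (encode c) ≡ c
decode-encode₂ : ∀ {f} t c d → height c ⊔ height d ≤ f →
                 decode (suc f) ⟨ t , ⟨ encode c , encode d ⟩ ⟩ ≡ build t c d (decode f ⟨ encode c , encode d ⟩)

decode-encode {suc f} zeroᶜ       (s≤s _) = decode-pair f 0 0
decode-encode {suc f} succᶜ       (s≤s _) = decode-pair f 1 0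
decode-encode {suc f} leftᶜ       (s≤s _) = decode-pair f 2 0
decode-encode {suc f} rightᶜ      (s≤s _) = decode-pair f 3 0
decode-encode {suc f} oracleᶜ     (s≤s _) = decode-pair f 4 0
decode-encode {suc f} (pairᶜ c d) (s≤s p) = decode-encode₂ 5 c d p
decode-encode {suc f} (compᶜ c d) (s≤s p) = decode-encode₂ 6 c d p
decode-encode {suc f} (precᶜ c d) (s≤s p) = decode-encode₂ 7 c d p
decode-encode {suc f} (muᶜ c)     (s≤s p) = trans (decode-pair f 8 (encode c)) (cong muᶜ (decode-encode c p))

decode-encode₂ {f} t c d p
  rewrite decode-pair f t ⟨ encode c , encode d ⟩
        | unpair-pair (encode c) (encode d)
        | decode-encode c (m⊔n≤o⇒m≤o (height c) (height d) p)
        | decode-encode d (m⊔n≤o⇒n≤o (height c) (height d) p) = refl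

encode-injective : ∀ c d → encode c ≡ encode d → c ≡ d
encode-injective c d p =
  trans (sym (decode-encode c (m≤m⊔n (height c) (height d))))
        (trans (cong (decode (height c ⊔ height d)) p) (decode-encode d (m≤n⊔m (height c) (height d))))

left-inv : ∀ {n v} → g ⊢ leftᶜ · n ⇓ v → proj₁ (unpair n) ≡ v
left-inv (left⇓ {x} {y}) = cong proj₁ (unpair-pair x y)

right-inv : ∀ {n v} → g ⊢ rightᶜ · n ⇓ v → proj₂ (unpair n) ≡ v
right-inv (right⇓ {x} {y}) = cong proj₂ (unpair-pair x y)

-- Indexed by the pair itself and not by its code: unification can invert the pair constructor, but
-- not `⟨_,_⟩`.
data PrecRun (g : Baire) (c d : Code) (v : ℕ) : ℕ × ℕ → Set where
  base : ∀ {x} → g ⊢ c · x ⇓ v → PrecRun g c d v (x , 0)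
  step : ∀ {x m u} → g ⊢ precᶜ c d · ⟨ x , m ⟩ ⇓ u → g ⊢ d · ⟨ x , ⟨ m , u ⟩ ⟩ ⇓ v → PrecRun g c d v (x , suc m)

prec-inv : ∀ {c d n v} → g ⊢ precᶜ c d · n ⇓ v → PrecRun g c d v (unpair n)
prec-inv (prec⇓₀ {x = x} p)           = subst (PrecRun _ _ _ _) (sym (unpair-pair x 0)) (base p)
prec-inv (prec⇓₊ {x = x} {n = n} p q) = subst (PrecRun _ _ _ _) (sym (unpair-pair x (suc n))) (step p q)

deterministic : ∀ {c n v w} → g ⊢ c · n ⇓ v → g ⊢ c · n ⇓ w → v ≡ w
deterministic zero⇓       zero⇓         = refl
deterministic succ⇓       succ⇓         = refl
deterministic p@left⇓     q             = trans (sym (left-inv p)) (left-inv q)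
deterministic p@right⇓    q             = trans (sym (right-inv p)) (right-inv q)
deterministic oracle⇓     oracle⇓       = refl
deterministic (pair⇓ p q) (pair⇓ p′ q′) = cong₂ ⟨_,_⟩ (deterministic p p′) (deterministic q q′)
deterministic (comp⇓ p q) (comp⇓ p′ q′) with deterministic p p′
... | refl = deterministic q q′
deterministic (prec⇓₀ {x = x} p) r with subst (PrecRun _ _ _ _) (unpair-pair x 0) (prec-inv r)
... | base p′ = deterministic p p′
deterministic (prec⇓₊ {x = x} {n = n} p q) r with subst (PrecRun _ _ _ _) (unpair-pair x (suc n)) (prec-inv r)
... | step p′ q′ with deterministic p p′
...   | refl = deterministic q q′
deterministic (mu⇓ {n = n} below at) (mu⇓ {n = m} below′ at′) with <-cmp n m
... | tri≈ _ n≡m _ = n≡m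
-- At the smaller of two different results the program would output both 0 and a successor.
... | tri< n<m _ _ = contradiction (deterministic at (proj₂ (below′ n n<m))) λ ()
... | tri> _ _ m<n = contradiction (deterministic (proj₂ (below m m<n)) at′) λ ()

-- Coded types

data Ty : Set where
  nat str : Ty
  _⊗_     : Ty → Ty → Ty

infixr 6 _⊗_

El : Ty → Set
El nat     = ℕ
El str     = Str
El (A ⊗ B) = El A × El B

private variable
  A B C : Ty

⌜_⌝ : El A → ℕ
⌜_⌝ {nat}   n       = n
⌜_⌝ {str}   σ       = encodeStr σ
⌜_⌝ {A ⊗ B} (a , b) = ⟨ ⌜ a ⌝ , ⌜ b ⌝ ⟩

encodeStr-surjective : ∀ n → ∃ λ σ → encodeStr σ ≡ n
encodeStr-surjective = <-rec _ λ where
  zero    _   → [] , refl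
  (suc n) rec →
    let a , r = unpair n
        σ , p = rec {r} (s≤s (subst (r ≤_) (pair-unpair n) (y≤⟨x,y⟩ a r)))
    in a ∷ σ , cong suc (trans (cong ⟨ a ,_⟩ p) (pair-unpair n))

encodeStr-injective : ∀ σ τ → encodeStr σ ≡ encodeStr τ → σ ≡ τ
encodeStr-injective []      []      p = refl
encodeStr-injective (a ∷ σ) (b ∷ τ) p =
  let q , r = pair-injective (suc-injective p) in cong₂ _∷_ q (encodeStr-injective σ τ r)

-- As the coding is a bijection with ℕ, a search through the numbers is a search through all
-- elements of the type, and decoding is computed by the identity program.
⌜⌝-surjective : ∀ A n → ∃ λ (a : El A) → ⌜ a ⌝ ≡ n
⌜⌝-surjective nat     n = n , refl
⌜⌝-surjective str     n = encodeStr-surjective n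
⌜⌝-surjective (A ⊗ B) n =
  let a , p = ⌜⌝-surjective A (proj₁ (unpair n))
      b , q = ⌜⌝-surjective B (proj₂ (unpair n))
  in (a , b) , trans (cong₂ ⟨_,_⟩ p q) (pair-unpair n)

⌜⌝-injective : (a b : El A) → ⌜ a ⌝ ≡ ⌜ b ⌝ → a ≡ b
⌜⌝-injective {nat}   a       b         p = p
⌜⌝-injective {str}   σ       τ         p = encodeStr-injective σ τ p
⌜⌝-injective {A ⊗ B} (a , b) (a′ , b′) p =
  let q , r = pair-injective {⌜ a ⌝} {⌜ b ⌝} {⌜ a′ ⌝} {⌜ b′ ⌝} p
  in cong₂ _,_ (⌜⌝-injective a a′ q) (⌜⌝-injective b b′ r)

-- Total functionals computable uniformly in the oracle

record Computable (f : Baire → El A → El B) : Set where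
  constructor by
  field
    code  : Code
    halts : ∀ g a → g ⊢ code · ⌜ a ⌝ ⇓ ⌜ f g a ⌝

open Computable

natrec : {X : Set} → X → (ℕ → X → X) → ℕ → X
natrec z s zero    = z
natrec z s (suc n) = s n (natrec z s n)

num : ℕ → Code
num zero    = zeroᶜ
num (suc n) = compᶜ succᶜ (num n)

num⇓ : ∀ n {x} → g ⊢ num n · x ⇓ n
num⇓ zero    = zero⇓
num⇓ (suc n) = comp⇓ (num⇓ n) succ⇓

identity : Code
identity = pairᶜ leftᶜ rightᶜ

identity⇓ : ∀ n → g ⊢ identity · n ⇓ n
identity⇓ {g} n = subst (λ n → g ⊢ identity · n ⇓ n) (pair-unpair n)
  (pair⇓ {u = x} {v = y} (left⇓ {x = x} {y}) (right⇓ {x = x} {y}))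
  where
  x = proj₁ (unpair n)
  y = proj₂ (unpair n)

idᶠ : Computable {A} {A} (λ _ a → a)
idᶠ = by identity λ _ a → identity⇓ ⌜ a ⌝

infixr 9 _∘ᶠ_

_∘ᶠ_ : {f : Baire → El B → El C} {h : Baire → El A → El B} →
       Computable f → Computable h → Computable (λ g a → f g (h g a))
by c p ∘ᶠ by d q = by (compᶜ c d) λ g a → comp⇓ (q g a) (p g _)

infixr 4 _,ᶠ_

_,ᶠ_ : {f : Baire → El A → El B} {h : Baire → El A → El C} →
       Computable f → Computable h → Computable {A} {B ⊗ C} (λ g a → f g a , h g a)
by c p ,ᶠ by d q = by (pairᶜ c d) λ g a → pair⇓ (p g a) (q g a)

fstᶠ : Computable {A ⊗ B} {A} (λ _ → proj₁)
fstᶠ = by leftᶜ λ _ (a , b) → left⇓ {x = ⌜ a ⌝} {⌜ b ⌝}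

sndᶠ : Computable {A ⊗ B} {B} (λ _ → proj₂)
sndᶠ = by rightᶜ λ _ (a , b) → right⇓ {x = ⌜ a ⌝} {⌜ b ⌝}

constᶠ : (b : El B) → Computable {A} (λ _ _ → b)
constᶠ b = by (num ⌜ b ⌝) λ _ _ → num⇓ ⌜ b ⌝

oracleᶠ : Computable {nat} {nat} (λ g n → g n)
oracleᶠ = by oracleᶜ λ _ _ → oracle⇓

encodeᶠ : Computable {A} {nat} (λ _ → ⌜_⌝)
encodeᶠ = by identity λ _ a → identity⇓ ⌜ a ⌝

decodeᶠ : Computable {nat} {A} (λ _ n → proj₁ (⌜⌝-surjective A n))
decodeᶠ {A} = by identity λ _ n →
  subst (_ ⊢ _ · n ⇓_) (sym (proj₂ (⌜⌝-surjective A n))) (identity⇓ n)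

recᶠ : {f : Baire → El A → El B} {h : Baire → El (A ⊗ nat ⊗ B) → El B} →
       Computable f → Computable h →
       Computable {A ⊗ nat} (λ g (a , n) → natrec (f g a) (λ i u → h g (a , i , u)) n)
recᶠ {A} {B} {f} {h} (by c p) (by d q) = by (precᶜ c d) λ g (a , n) → run g a n
  where
  run : ∀ g a n → g ⊢ precᶜ c d · ⟨ ⌜ a ⌝ , n ⟩ ⇓ ⌜ natrec (f g a) (λ i u → h g (a , i , u)) n ⌝
  run g a zero    = prec⇓₀ {x = ⌜ a ⌝} (p g a)
  run g a (suc n) = prec⇓₊ {x = ⌜ a ⌝} {n} (run g a n) (q g (a , n , _))

sucᶠ : Computable {nat} {nat} (λ _ → suc)
sucᶠ = by succᶜ λ _ _ → succ⇓

extᶠ : {f h : Baire → El A → El B} → (∀ g a → f g a ≡ h g a) → Computable f → Computable h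
extᶠ e (by c p) = by c λ g a → subst (λ b → g ⊢ c · ⌜ a ⌝ ⇓ ⌜ b ⌝) (e g a) (p g a)

if0 : {X : Set} → ℕ → X → X → X
if0 zero    x y = x
if0 (suc _) x y = y

if0-elim : {X : Set} (P : X → Set) → ∀ n {x y} → (n ≡ 0 → P x) → (n ≢ 0 → P y) → P (if0 n x y)
if0-elim P zero    p q = p refl
if0-elim P (suc n) p q = q λ ()

if0ᶠ : {t : Baire → El A → ℕ} {f h : Baire → El A → El B} →
       Computable {A} {nat} t → Computable f → Computable h → Computable (λ g a → if0 (t g a) (f g a) (h g a))
if0ᶠ {t = t} {f} {h} T F H = extᶠ (λ g a → cases g a (t g a)) (recᶠ F (H ∘ᶠ fstᶠ) ∘ᶠ (idᶠ ,ᶠ T))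
  where
  cases : ∀ g a n → natrec (f g a) (λ _ _ → h g a) n ≡ if0 n (f g a) (h g a)
  cases g a zero    = refl
  cases g a (suc n) = refl

-- Failure below the least zero is given in the form of the premise of `mu⇓`.
minimise : (p : ℕ → ℕ) → ∃ (λ n → p n ≡ 0) → ∃ λ n → p n ≡ 0 × ∀ m → m < n → ∃ λ v → p m ≡ suc v
minimise p (n , pn) = go p n pn
  where
  go : (p : ℕ → ℕ) → ∀ n → p n ≡ 0 → ∃ λ n → p n ≡ 0 × ∀ m → m < n → ∃ λ v → p m ≡ suc v
  go p n pn with p 0 in p0
  ... | zero  = 0 , p0 , λ _ ()
  go p zero    pn | suc v = contradiction (trans (sym pn) p0) λ ()
  go p (suc n) pn | suc v =
    let m , pm , below = go (p ∘ suc) n pn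
    in suc m , pm , λ { zero _ → v , p0 ; (suc i) (s≤s i<m) → below i i<m }

-- Conditions are given by functions into ℕ, with 0 for true.
opaque
  searchᶠ : {t : Baire → El (A ⊗ B) → ℕ} → Computable {A ⊗ B} {nat} t → (∀ g a → ∃ λ b → t g (a , b) ≡ 0) →
            ∃ λ (f : Baire → El A → El B) → Computable f × ∀ g a → t g (a , f g a) ≡ 0
  searchᶠ {A} {B} {t} (by c p) total = f , decodeᶠ ∘ᶠ (by (muᶜ c) runs) , λ g a → proj₁ (proj₂ (least g a))
    where
    dec : ℕ → El B
    dec n = proj₁ (⌜⌝-surjective B n)
    -- The witness from `total` only ensures that the search ends. The program is `muᶜ c` in any
    -- case, so `total` may come from a classical proof.
    least : ∀ g a → ∃ λ n → t g (a , dec n) ≡ 0 × ∀ m → m < n → ∃ λ v → t g (a , dec m) ≡ suc v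
    least g a = minimise (λ n → t g (a , dec n))
      let b , q = total g a
      in ⌜ b ⌝ , trans (cong (λ b → t g (a , b)) (⌜⌝-injective _ b (proj₂ (⌜⌝-surjective B ⌜ b ⌝)))) q
    f : Baire → El A → El B
    f g a = dec (proj₁ (least g a))
    eval : ∀ g a n → g ⊢ c · ⟨ ⌜ a ⌝ , n ⟩ ⇓ t g (a , dec n)
    eval g a n = subst (λ m → g ⊢ c · ⟨ ⌜ a ⌝ , m ⟩ ⇓ t g (a , dec n)) (proj₂ (⌜⌝-surjective B n)) (p g (a , dec n))
    runs : ∀ g a → g ⊢ muᶜ c · ⌜ a ⌝ ⇓ proj₁ (least g a)
    runs g a with least g a | eval g a
    ... | n , q , below | ev = mu⇓ (λ m m<n → let v , r = below m m<n in v , subst (g ⊢ c · _ ⇓_) r (ev m))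
                                   (subst (g ⊢ c · _ ⇓_) q (ev n))

-- Arithmetic, connectives and bounded quantification.

predᶠ : Computable {nat} {nat} (λ _ → pred)
predᶠ = extᶠ (λ { g zero → refl ; g (suc n) → refl })
  (recᶠ {nat} (constᶠ 0) (fstᶠ ∘ᶠ sndᶠ) ∘ᶠ (idᶠ ,ᶠ idᶠ))

+ᶠ : Computable {nat ⊗ nat} {nat} (λ _ (m , n) → m + n)
+ᶠ = extᶠ (λ g (m , n) → correct m n) (recᶠ idᶠ (sucᶠ ∘ᶠ sndᶠ ∘ᶠ sndᶠ))
  where
  correct : ∀ m n → natrec m (λ _ → suc) n ≡ m + n
  correct m zero    = sym (+-identityʳ m)
  correct m (suc n) = trans (cong suc (correct m n)) (sym (+-suc m n))

*ᶠ : Computable {nat ⊗ nat} {nat} (λ _ (m , n) → m * n)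
*ᶠ = extᶠ (λ g (m , n) → trans (correct m n) (*-comm n m)) (recᶠ (constᶠ 0) (+ᶠ ∘ᶠ (fstᶠ ,ᶠ sndᶠ ∘ᶠ sndᶠ)))
  where
  correct : ∀ m n → natrec 0 (λ _ u → m + u) n ≡ n * m
  correct m zero    = refl
  correct m (suc n) = cong (m +_) (correct m n)

∸ᶠ : Computable {nat ⊗ nat} {nat} (λ _ (m , n) → m ∸ n)
∸ᶠ = extᶠ (λ g (m , n) → correct m n) (recᶠ idᶠ (predᶠ ∘ᶠ sndᶠ ∘ᶠ sndᶠ))
  where
  correct : ∀ m n → natrec m (λ _ → pred) n ≡ m ∸ n
  correct m zero    = refl
  correct m (suc n) = trans (cong pred (correct m n)) (pred[m∸n]≡m∸[1+n] m n)

opaque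
  not : ℕ → ℕ
  not n = 1 ∸ n

  notᶠ : Computable {nat} {nat} (λ _ → not)
  notᶠ = ∸ᶠ ∘ᶠ (constᶠ 1 ,ᶠ idᶠ)

  not-true : ∀ {n} → n ≢ 0 → not n ≡ 0
  not-true {zero}  p = contradiction refl p
  not-true {suc n} p = 0∸n≡0 n

  not-false : ∀ {n} → not n ≡ 0 → n ≢ 0
  not-false () refl

infixr 5 _⇒_

opaque
  unfolding not

  -- With 0 for true, a product is a disjunction.
  _⇒_ : ℕ → ℕ → ℕ
  m ⇒ n = not m * n

  ⇒ᶠ : Computable {nat ⊗ nat} {nat} (λ _ (m , n) → m ⇒ n)
  ⇒ᶠ = *ᶠ ∘ᶠ (notᶠ ∘ᶠ fstᶠ ,ᶠ sndᶠ)

  ⇒-intro : ∀ m {n} → (m ≡ 0 → n ≡ 0) → (m ⇒ n) ≡ 0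
  ⇒-intro zero    p = trans (+-identityʳ _) (p refl)
  ⇒-intro (suc m) {n} p = cong (_* n) (0∸n≡0 m)

  ⇒-elim : ∀ {m n} → (m ⇒ n) ≡ 0 → m ≡ 0 → n ≡ 0
  ⇒-elim p refl = trans (sym (+-identityʳ _)) p

equal : ℕ → ℕ → ℕ
equal m n = (m ∸ n) + (n ∸ m)

equalᶠ : Computable {nat ⊗ nat} {nat} (λ _ (m , n) → equal m n)
equalᶠ = +ᶠ ∘ᶠ (∸ᶠ ,ᶠ ∸ᶠ ∘ᶠ (sndᶠ ,ᶠ fstᶠ))

equal-refl : ∀ n → equal n n ≡ 0
equal-refl n = cong₂ _+_ (n∸n≡0 n) (n∸n≡0 n)

equal⇒≡ : ∀ {m n} → equal m n ≡ 0 → m ≡ n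
equal⇒≡ {m} {n} p = ≤-antisym (m∸n≡0⇒m≤n (m+n≡0⇒m≡0 (m ∸ n) p)) (m∸n≡0⇒m≤n (m+n≡0⇒n≡0 (m ∸ n) p))

-- With 0 for true, addition is conjunction and a finite sum is a bounded universal quantifier.
∑ : (ℕ → ℕ) → ℕ → ℕ
∑ f = natrec 0 (λ i u → f i + u)

∑ᶠ : {f : Baire → El (A ⊗ nat) → ℕ} → Computable {A ⊗ nat} {nat} f →
     Computable {A ⊗ nat} {nat} (λ g (a , n) → ∑ (λ i → f g (a , i)) n)
∑ᶠ F = recᶠ (constᶠ 0) (+ᶠ ∘ᶠ (F ∘ᶠ (fstᶠ ,ᶠ fstᶠ ∘ᶠ sndᶠ) ,ᶠ sndᶠ ∘ᶠ sndᶠ))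

∑≡0 : ∀ f n → (∀ i → i < n → f i ≡ 0) → ∑ f n ≡ 0
∑≡0 f zero    p = refl
∑≡0 f (suc n) p = cong₂ _+_ (p n ≤-refl) (∑≡0 f n λ i i<n → p i (m<n⇒m<1+n i<n))

∑≡0⁻¹ : ∀ f n → ∑ f n ≡ 0 → ∀ i → i < n → f i ≡ 0
∑≡0⁻¹ f (suc n) p i (s≤s i≤n) with m≤n⇒m<n∨m≡n i≤n
... | inj₁ i<n  = ∑≡0⁻¹ f n (m+n≡0⇒n≡0 (f n) p) i i<n
... | inj₂ refl = m+n≡0⇒m≡0 (f n) p

-- Strings

natrec-shift : {X : Set} (f : X → X) (x : X) → ∀ n → natrec x (λ _ → f) (suc n) ≡ natrec (f x) (λ _ → f) n
natrec-shift f x zero    = refl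
natrec-shift f x (suc n) = cong f (natrec-shift f x n)

hd : Str → ℕ
hd []      = 0
hd (a ∷ σ) = a

tl : Str → Str
tl []      = []
tl (a ∷ σ) = σ

-- The code of `a ∷ σ` is the successor of the code of the pair `(a , σ)`, so the program is just
-- the successor.
consᶠ : Computable {nat ⊗ str} {str} (λ _ (a , σ) → a ∷ σ)
consᶠ = by (code sucᶠ) λ _ (a , σ) → halts sucᶠ _ ⟨ a , encodeStr σ ⟩

hdᶠ : Computable {str} {nat} (λ _ → hd)
hdᶠ = by (compᶜ leftᶜ (code predᶠ)) λ where
  -- The empty string has code 0, and `pred 0` is `⟨ 0 , 0 ⟩`, whose left part is the default value
  -- of `hd`.
  _ []      → comp⇓ (halts predᶠ _ 0) (left⇓ {x = 0} {0})
  _ (a ∷ σ) → comp⇓ (halts predᶠ _ (suc _)) (left⇓ {x = a} {encodeStr σ})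

tlᶠ : Computable {str} {str} (λ _ → tl)
tlᶠ = by (compᶜ rightᶜ (code predᶠ)) λ where
  _ []      → comp⇓ (halts predᶠ _ 0) (right⇓ {x = 0} {0})
  _ (a ∷ σ) → comp⇓ (halts predᶠ _ (suc _)) (right⇓ {x = a} {encodeStr σ})

dropᶠ : Computable {str ⊗ nat} {str} (λ _ (σ , n) → drop n σ)
dropᶠ = extᶠ (λ g (σ , n) → correct σ n) (recᶠ idᶠ (tlᶠ ∘ᶠ sndᶠ ∘ᶠ sndᶠ))
  where
  correct : ∀ σ n → natrec σ (λ _ → tl) n ≡ drop n σ
  correct σ       zero    = refl
  correct []      (suc n) = cong tl (trans (correct [] n) (drop-[] n))
    where
    drop-[] : ∀ n → drop {A = ℕ} n [] ≡ []
    drop-[] zero    = refl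
    drop-[] (suc n) = refl
  correct (a ∷ σ) (suc n) = trans (natrec-shift tl (a ∷ σ) n) (correct σ n)

at : Str → ℕ → ℕ
at σ n = hd (drop n σ)

atᶠ : Computable {str ⊗ nat} {nat} (λ _ (σ , n) → at σ n)
atᶠ = hdᶠ ∘ᶠ dropᶠ

length≤encode : ∀ σ → length σ ≤ encodeStr σ
length≤encode []      = z≤n
length≤encode (a ∷ σ) = s≤s (≤-trans (length≤encode σ) (y≤⟨x,y⟩ a _))

-- Moves one letter across and rests once the first string is empty. Hence any number of rounds from
-- the length on completes the reversal, and the code of the string can serve as that number.
shunt : Str × Str → Str × Str
shunt (σ , τ) = tl σ , if0 (encodeStr σ) τ (hd σ ∷ τ)

shuntᶠ : Computable {str ⊗ str} {str ⊗ str} (λ _ → shunt)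
shuntᶠ = tlᶠ ∘ᶠ fstᶠ ,ᶠ if0ᶠ (encodeᶠ ∘ᶠ fstᶠ) sndᶠ (consᶠ ∘ᶠ (hdᶠ ∘ᶠ fstᶠ ,ᶠ sndᶠ))

shunt-ʳ++ : ∀ σ τ n → length σ ≤ n → natrec (σ , τ) (λ _ → shunt) n ≡ ([] , σ ʳ++ τ)
shunt-ʳ++ []      τ zero    p       = refl
shunt-ʳ++ []      τ (suc n) p       = cong shunt (shunt-ʳ++ [] τ n z≤n)
shunt-ʳ++ (a ∷ σ) τ (suc n) (s≤s p) = trans (natrec-shift shunt (a ∷ σ , τ) n) (shunt-ʳ++ σ (a ∷ τ) n p)

ʳ++ᶠ : Computable {str ⊗ str} {str} (λ _ (σ , τ) → σ ʳ++ τ)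
ʳ++ᶠ = extᶠ (λ g (σ , τ) → cong proj₂ (shunt-ʳ++ σ τ _ (length≤encode σ)))
  (sndᶠ ∘ᶠ recᶠ idᶠ (shuntᶠ ∘ᶠ sndᶠ ∘ᶠ sndᶠ) ∘ᶠ (idᶠ ,ᶠ encodeᶠ ∘ᶠ fstᶠ))

++ᶠ : Computable {str ⊗ str} {str} (λ _ (σ , τ) → σ ++ τ)
++ᶠ = extᶠ (λ g (σ , τ) → trans (ʳ++-defn (σ ʳ++ [])) (cong (_++ τ) (reverse-involutive σ)))
  (ʳ++ᶠ ∘ᶠ (ʳ++ᶠ ∘ᶠ (fstᶠ ,ᶠ constᶠ []) ,ᶠ sndᶠ))

∷ʳᶠ : Computable {str ⊗ nat} {str} (λ _ (σ , a) → σ ∷ʳ a)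
∷ʳᶠ = ++ᶠ ∘ᶠ (fstᶠ ,ᶠ consᶠ ∘ᶠ (sndᶠ ,ᶠ constᶠ []))

applyUpToᶠ : {f : Baire → El (A ⊗ nat) → ℕ} → Computable {A ⊗ nat} {nat} f →
             Computable {A ⊗ nat} {str} (λ g (a , n) → applyUpTo (λ i → f g (a , i)) n)
applyUpToᶠ {A = A} {f = f} F = extᶠ (λ g (a , n) → correct g a n)
  (recᶠ (constᶠ []) (∷ʳᶠ ∘ᶠ (sndᶠ ∘ᶠ sndᶠ ,ᶠ F ∘ᶠ (fstᶠ ,ᶠ fstᶠ ∘ᶠ sndᶠ))))
  where
  correct : ∀ g (a : El A) n → natrec [] (λ i u → u ∷ʳ f g (a , i)) n ≡ applyUpTo (λ i → f g (a , i)) n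
  correct g a zero    = refl
  correct g a (suc n) = trans (cong (_∷ʳ f g (a , n)) (correct g a n)) (applyUpTo-∷ʳ (λ i → f g (a , i)) n)

replicateᶠ : ∀ k → Computable {nat} {str} (λ _ n → replicate n k)
replicateᶠ k = extᶠ (λ g → correct)
  (recᶠ {nat} (constᶠ []) (consᶠ ∘ᶠ (constᶠ k ,ᶠ sndᶠ ∘ᶠ sndᶠ)) ∘ᶠ (idᶠ ,ᶠ idᶠ))
  where
  correct : ∀ n → natrec [] (λ _ → k ∷_) n ≡ replicate n k
  correct zero    = refl
  correct (suc n) = cong (k ∷_) (correct n)

-- Computable sets of strings in the presence of an oracle.

eraseOracle : Code → Code
eraseOracle oracleᶜ     = zeroᶜ
eraseOracle (pairᶜ c d) = pairᶜ (eraseOracle c) (eraseOracle d)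
eraseOracle (compᶜ c d) = compᶜ (eraseOracle c) (eraseOracle d)
eraseOracle (precᶜ c d) = precᶜ (eraseOracle c) (eraseOracle d)
eraseOracle (muᶜ c)     = muᶜ (eraseOracle c)
eraseOracle c           = c

-- The tree is decided with the zero oracle, whereas the reduction runs with oracle `g`; answering
-- every query by 0 makes the run the same for all oracles.
eraseOracle⇓ : ∀ {c n v} → c · n ⇓ v → g ⊢ eraseOracle c · n ⇓ v
eraseOracle⇓ zero⇓        = zero⇓
eraseOracle⇓ succ⇓        = succ⇓
eraseOracle⇓ (left⇓ {x} {y})  = left⇓ {x = x} {y}
eraseOracle⇓ (right⇓ {x} {y}) = right⇓ {x = x} {y}
eraseOracle⇓ oracle⇓      = zero⇓
eraseOracle⇓ (pair⇓ p q)  = pair⇓ (eraseOracle⇓ p) (eraseOracle⇓ q)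
eraseOracle⇓ (comp⇓ p q)  = comp⇓ (eraseOracle⇓ p) (eraseOracle⇓ q)
eraseOracle⇓ (prec⇓₀ {x = x} p) = prec⇓₀ {x = x} (eraseOracle⇓ p)
eraseOracle⇓ (prec⇓₊ {x = x} {n = n} p q) = prec⇓₊ {x = x} {n = n} (eraseOracle⇓ p) (eraseOracle⇓ q)
eraseOracle⇓ (mu⇓ below p) = mu⇓ (λ m m<n → let v , q = below m m<n in v , eraseOracle⇓ q) (eraseOracle⇓ p)

opaque
  unfolding not

  member : {S : Pred Str 0ℓ} → ComputableSet S →
           ∃ λ (χ : Str → ℕ) → Computable {str} {nat} (λ _ → χ) × (∀ σ → σ ∈ S → χ σ ≡ 0) × (∀ σ → χ σ ≡ 0 → σ ∈ S)
  -- The deciding program outputs 1 on members, whereas here 0 is true; hence the negation.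
  member {S} (c , dec) = χ , by (compᶜ (code notᶠ) (eraseOracle c)) (λ _ → runs) , complete , sound
    where
    χ : Str → ℕ
    χ σ with dec σ
    ... | inj₁ _ = 0
    ... | inj₂ _ = 1
    complete : ∀ σ → σ ∈ S → χ σ ≡ 0
    complete σ σ∈S with dec σ
    ... | inj₁ _         = refl
    ... | inj₂ (σ∉S , _) = contradiction σ∈S σ∉S
    sound : ∀ σ → χ σ ≡ 0 → σ ∈ S
    sound σ χ≡0 with dec σ
    ... | inj₁ (σ∈S , _) = σ∈S
    sound σ () | inj₂ _
    runs : ∀ {g} σ → g ⊢ compᶜ (code notᶠ) (eraseOracle c) · encodeStr σ ⇓ χ σ
    runs σ with dec σ
    ... | inj₁ (_ , p) = comp⇓ (eraseOracle⇓ p) (halts notᶠ _ 1)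
    ... | inj₂ (_ , p) = comp⇓ (eraseOracle⇓ p) (halts notᶠ _ 0)

-- Running a program with a finite part of the oracle

-- Composition of partial results, where 0 is undefined and `suc v` is the value `v`.
bind : ℕ → (ℕ → ℕ) → ℕ
bind zero    f = 0
bind (suc v) f = f v

bindᶠ : {f : Baire → El A → ℕ} {h : Baire → El (A ⊗ nat) → ℕ} →
        Computable {A} {nat} f → Computable {A ⊗ nat} {nat} h →
        Computable {A} {nat} (λ g a → bind (f g a) (λ v → h g (a , v)))
bindᶠ {f = f} {h} F H = extᶠ (λ g a → cases g a (f g a))
  (recᶠ (constᶠ 0) (H ∘ᶠ (fstᶠ ,ᶠ fstᶠ ∘ᶠ sndᶠ)) ∘ᶠ (idᶠ ,ᶠ F))
  where
  cases : ∀ g a n → natrec 0 (λ i _ → h g (a , i)) n ≡ bind n (λ v → h g (a , v))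
  cases g a zero    = refl
  cases g a (suc n) = refl

bind-inv : ∀ n {f v} → bind n f ≡ suc v → ∃ λ m → n ≡ suc m × f m ≡ suc v
bind-inv (suc m) p = m , refl , p

query : Str → ℕ
query σ = if0 (encodeStr σ) 0 (suc (hd σ))

-- The state of a minimisation is 0 (undefined), 1 (no zero found yet) or
-- 2 + the least zero.
scan : ℕ → ℕ → ℕ → ℕ
scan i r s = if0 (equal s 1) (if0 r 0 (if0 (pred r) (2 + i) 1)) s

scanᶠ : Computable {nat ⊗ nat ⊗ nat} {nat} (λ _ (i , r , s) → scan i r s)
scanᶠ = if0ᶠ (equalᶠ ∘ᶠ (s ,ᶠ constᶠ 1))
  (if0ᶠ r (constᶠ 0) (if0ᶠ (predᶠ ∘ᶠ r) (sucᶠ ∘ᶠ sucᶠ ∘ᶠ fstᶠ) (constᶠ 1))) s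
  where
  r = fstᶠ ∘ᶠ sndᶠ {nat}
  s = sndᶠ ∘ᶠ sndᶠ {nat}

-- 0 if the run of c on n is not completed within σ, whose code also bounds the
-- minimisations, and 1 + the output otherwise.
simulate : Code → Str × ℕ → ℕ
simulatePrec : Code → Code → Str → ℕ × ℕ → ℕ
search : Code → Str × ℕ → ℕ → ℕ

simulate zeroᶜ       (σ , n) = 1
simulate succᶜ       (σ , n) = 2 + n
simulate leftᶜ       (σ , n) = suc (proj₁ (unpair n))
simulate rightᶜ      (σ , n) = suc (proj₂ (unpair n))
simulate oracleᶜ     (σ , n) = query (drop n σ)
simulate (pairᶜ c d) (σ , n) = bind (simulate c (σ , n)) λ u → bind (simulate d (σ , n)) λ v → suc ⟨ u , v ⟩
simulate (compᶜ c d) (σ , n) = bind (simulate d (σ , n)) λ u → simulate c (σ , u)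
simulate (precᶜ c d) (σ , n) =
  simulatePrec c d σ (unpair n)
-- `pred` turns the states 0 and 1 into undefined and the state `2 + j` into the value `j`.
simulate (muᶜ c)     (σ , n) = pred (search c (σ , n) (encodeStr σ))

simulatePrec c d σ (x , n) =
  natrec (simulate c (σ , x)) (λ i r → bind r λ u → simulate d (σ , ⟨ x , ⟨ i , u ⟩ ⟩)) n

search c (σ , n) = natrec 1 (λ i → scan i (simulate c (σ , ⟨ n , i ⟩)))

simulateᶠ : ∀ c → Computable {str ⊗ nat} {nat} (λ _ → simulate c)
simulateᶠ zeroᶜ       = constᶠ 1
simulateᶠ succᶜ       = sucᶠ ∘ᶠ sucᶠ ∘ᶠ sndᶠ
simulateᶠ leftᶜ       = sucᶠ ∘ᶠ fstᶠ ∘ᶠ decodeᶠ {nat ⊗ nat} ∘ᶠ sndᶠ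
simulateᶠ rightᶜ      = sucᶠ ∘ᶠ sndᶠ ∘ᶠ decodeᶠ {nat ⊗ nat} ∘ᶠ sndᶠ
simulateᶠ oracleᶜ     = if0ᶠ encodeᶠ (constᶠ 0) (sucᶠ ∘ᶠ hdᶠ) ∘ᶠ dropᶠ
simulateᶠ (pairᶜ c d) = bindᶠ (simulateᶠ c)
  (bindᶠ (simulateᶠ d ∘ᶠ fstᶠ) (sucᶠ ∘ᶠ encodeᶠ {nat ⊗ nat} ∘ᶠ (sndᶠ ∘ᶠ fstᶠ ,ᶠ sndᶠ)))
simulateᶠ (compᶜ c d) = bindᶠ (simulateᶠ d) (simulateᶠ c ∘ᶠ (fstᶠ ∘ᶠ fstᶠ ,ᶠ sndᶠ))
simulateᶠ (precᶜ c d) =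
  recᶠ (simulateᶠ c)
       (bindᶠ (sndᶠ ∘ᶠ sndᶠ)
              (simulateᶠ d ∘ᶠ (fstᶠ ∘ᶠ fstᶠ ∘ᶠ fstᶠ ,ᶠ
                encodeᶠ {nat ⊗ nat ⊗ nat} ∘ᶠ (sndᶠ ∘ᶠ fstᶠ ∘ᶠ fstᶠ ,ᶠ fstᶠ ∘ᶠ sndᶠ ∘ᶠ fstᶠ ,ᶠ sndᶠ))))
  ∘ᶠ ((fstᶠ ,ᶠ fstᶠ ∘ᶠ split) ,ᶠ sndᶠ ∘ᶠ split)
  where
  split = decodeᶠ {nat ⊗ nat} ∘ᶠ sndᶠ {str}
simulateᶠ (muᶜ c)     =
  predᶠ ∘ᶠ
  recᶠ (constᶠ 1)
       (scanᶠ ∘ᶠ (fstᶠ ∘ᶠ sndᶠ ,ᶠ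
                  simulateᶠ c ∘ᶠ (fstᶠ ∘ᶠ fstᶠ ,ᶠ encodeᶠ {nat ⊗ nat} ∘ᶠ (sndᶠ ∘ᶠ fstᶠ ,ᶠ fstᶠ ∘ᶠ sndᶠ)) ,ᶠ
                  sndᶠ ∘ᶠ sndᶠ))
  ∘ᶠ (idᶠ ,ᶠ encodeᶠ ∘ᶠ fstᶠ)

SearchState : Code → Str × ℕ → ℕ → ℕ → Set
SearchState c (σ , n) i 0             = ⊤
SearchState c (σ , n) i 1             = ∀ m → m < i → ∃ λ v → simulate c (σ , ⟨ n , m ⟩) ≡ 2 + v
SearchState c (σ , n) i (suc (suc j)) =
  (∀ m → m < j → ∃ λ v → simulate c (σ , ⟨ n , m ⟩) ≡ 2 + v) × simulate c (σ , ⟨ n , j ⟩) ≡ 1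

search-state : ∀ c σ n i → SearchState c (σ , n) i (search c (σ , n) i)
search-state c σ n zero    m ()
search-state c σ n (suc i) with search c (σ , n) i | search-state c σ n i
... | 0           | _ = tt
... | suc (suc j) | q = q
... | 1           | q with simulate c (σ , ⟨ n , i ⟩) in r
...   | 0           = tt
...   | 1           = q , r
...   | suc (suc v) = λ m m<1+i → case m≤n⇒m<n∨m≡n (s≤s⁻¹ m<1+i) of λ where
  (inj₁ m<i)  → q m m<i
  (inj₂ refl) → v , r

-- Says that `σ` is an initial segment of `g`, in the form in which `simulate` reads its queries.
Agrees : Baire → Str → Set
Agrees g σ = ∀ n {a τ} → drop n σ ≡ a ∷ τ → g n ≡ a

-- The use principle: a run completed within `σ` has seen nothing of the oracle beyond `σ`, so it is
-- a run for every oracle that begins with `σ`.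
simulate-sound : ∀ c {σ n v} → Agrees g σ → simulate c (σ , n) ≡ suc v → g ⊢ c · n ⇓ v
simulate-sound zeroᶜ   ag refl = zero⇓
simulate-sound succᶜ   ag refl = succ⇓
simulate-sound leftᶜ  {n = n} ag refl =
  subst (λ m → _ ⊢ leftᶜ · m ⇓ proj₁ (unpair n)) (pair-unpair n) (left⇓ {x = proj₁ (unpair n)} {proj₂ (unpair n)})
simulate-sound rightᶜ {n = n} ag refl =
  subst (λ m → _ ⊢ rightᶜ · m ⇓ proj₂ (unpair n)) (pair-unpair n) (right⇓ {x = proj₁ (unpair n)} {proj₂ (unpair n)})
simulate-sound oracleᶜ {σ} {n} ag p with drop n σ in q
simulate-sound oracleᶜ {σ} {n} ag refl | a ∷ τ = subst (_ ⊢ oracleᶜ · n ⇓_) (ag n q) oracle⇓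
simulate-sound (pairᶜ c d) {σ} {n} ag p with bind-inv (simulate c (σ , n)) p
... | u , q , p′ with bind-inv (simulate d (σ , n)) p′
...   | v , r , refl = pair⇓ (simulate-sound c ag q) (simulate-sound d ag r)
simulate-sound (compᶜ c d) {σ} {n} ag p with bind-inv (simulate d (σ , n)) p
... | u , q , r = comp⇓ (simulate-sound d ag q) (simulate-sound c ag r)
simulate-sound {g} (precᶜ c d) {σ} {n} ag p =
  subst (g ⊢ precᶜ c d ·_⇓ _) (pair-unpair n) (run (proj₂ (unpair n)) p)
  where
  x = proj₁ (unpair n)
  run : ∀ i {v} →
        simulatePrec c d σ (x , i) ≡ suc v →
        g ⊢ precᶜ c d · ⟨ x , i ⟩ ⇓ v
  run zero    p = prec⇓₀ {x = x} (simulate-sound c ag p)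
  run (suc i) p with bind-inv (simulatePrec c d σ (x , i)) p
  ... | u , q , r = prec⇓₊ {x = x} {n = i} (run i q) (simulate-sound d ag r)
simulate-sound (muᶜ c) {σ} {n} ag p
  with search c (σ , n) (encodeStr σ) | search-state c σ n (encodeStr σ)
simulate-sound (muᶜ c) ag refl | suc (suc j) | below , r =
  mu⇓ (λ m m<j → let v , q = below m m<j in v , simulate-sound c ag q) (simulate-sound c ag r)

-- Asking for all large `n` lets the bounds for several subcomputations be merged by taking their
-- maximum.
Eventually : (ℕ → Set) → Set
Eventually P = ∃ λ N → ∀ n → N ≤ n → P n

eventually₂ : ∀ {P Q R : ℕ → Set} → (∀ {n} → P n → Q n → R n) → Eventually P → Eventually Q → Eventually R
eventually₂ f (M , p) (N , q) =
  M ⊔ N , λ n M⊔N≤n → f (p n (≤-trans (m≤m⊔n M N) M⊔N≤n)) (q n (≤-trans (m≤n⊔m M N) M⊔N≤n))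

eventually-below : ∀ {P : ℕ → ℕ → Set} b → (∀ m → m < b → Eventually (P m)) → Eventually (λ n → ∀ m → m < b → P m n)
eventually-below zero    p = 0 , λ _ _ _ ()
eventually-below {P} (suc b) p = eventually₂ {P b} combine (p b ≤-refl)
                                 (eventually-below b λ m m<b → p m (m<n⇒m<1+n m<b))
  where
  combine : ∀ {n} → P b n → (∀ m → m < b → P m n) → ∀ m → m < suc b → P m n
  combine q r m (s≤s m≤b) with m≤n⇒m<n∨m≡n m≤b
  ... | inj₁ m<b  = r m m<b
  ... | inj₂ refl = q

drop-applyUpTo : ∀ (f : Baire) {i n} → i < n → ∃ λ τ → drop i (applyUpTo f n) ≡ f i ∷ τ
drop-applyUpTo f {zero}  (s≤s _) = _ , refl
drop-applyUpTo f {suc i} (s≤s p) = drop-applyUpTo (f ∘ suc) p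

search-pending : ∀ c σ n i → (∀ m → m < i → ∃ λ v → simulate c (σ , ⟨ n , m ⟩) ≡ 2 + v) → search c (σ , n) i ≡ 1
search-pending c σ n zero    p = refl
search-pending c σ n (suc i) p
  rewrite search-pending c σ n i (λ m m<i → p m (m<n⇒m<1+n m<i)) | proj₂ (p i ≤-refl) = refl

search-found : ∀ c σ n j i → j < i → (∀ m → m < j → ∃ λ v → simulate c (σ , ⟨ n , m ⟩) ≡ 2 + v) →
               simulate c (σ , ⟨ n , j ⟩) ≡ 1 → search c (σ , n) i ≡ 2 + j
search-found c σ n j (suc i) (s≤s j≤i) p q with m≤n⇒m<n∨m≡n j≤i
... | inj₁ j<i  rewrite search-found c σ n j i j<i p q = refl
... | inj₂ refl rewrite search-pending c σ n i p | q = refl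

-- A halting run makes finitely many queries and minimisations. A long enough initial segment
-- answers the queries, and its code, being at least its length, also exceeds the results of the
-- minimisations.
simulate-complete : ∀ {c n v} → g ⊢ c · n ⇓ v → Eventually λ N → simulate c (applyUpTo g N , n) ≡ suc v
simulate-complete zero⇓          = 0 , λ _ _ → refl
simulate-complete succ⇓          = 0 , λ _ _ → refl
simulate-complete (left⇓ {x} {y})  = 0 , λ _ _ → cong (suc ∘ proj₁) (unpair-pair x y)
simulate-complete (right⇓ {x} {y}) = 0 , λ _ _ → cong (suc ∘ proj₂) (unpair-pair x y)
simulate-complete {g} (oracle⇓ {n}) = suc n , λ N n<N → cong query (proj₂ (drop-applyUpTo g n<N))
simulate-complete {g} (pair⇓ {n = n} {u = u} p q) = eventually₂
  (λ {N} r s → trans (cong (λ r → bind r _) r)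
     (cong (λ s → bind s (λ v → suc ⟨ u , v ⟩)) s))
  (simulate-complete p) (simulate-complete q)
simulate-complete (comp⇓ p q) = eventually₂
  (λ r s → trans (cong (λ r → bind r _) r) s)
  (simulate-complete p) (simulate-complete q)
simulate-complete {g} (prec⇓₀ {c = c} {d = d} {x = x} p) = let N , q = simulate-complete p in
  N , λ n N≤n → trans (cong (λ p → simulatePrec c d (applyUpTo g n) p) (unpair-pair x 0)) (q n N≤n)
simulate-complete {g} (prec⇓₊ {c = c} {d = d} {x = x} {n = i} p q) = eventually₂
  (λ {N} r s → trans (cong (simulatePrec c d (applyUpTo g N)) (unpair-pair x (suc i)))
    (trans (cong (λ r → bind r (λ u → simulate d (applyUpTo g N , ⟨ x , ⟨ i , u ⟩ ⟩)))
                 (trans (cong (simulatePrec c d (applyUpTo g N)) (sym (unpair-pair x i))) r))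
           s))
  (simulate-complete p) (simulate-complete q)
simulate-complete {g} (mu⇓ {c = c} {x = x} {n = n} below p) = eventually₂ combine late
  (eventually₂ _,_ (eventually-below n λ m m<n → let v , q = below m m<n
                                                     N , r = simulate-complete q
                                                 in N , λ i N≤i → v , r i N≤i)
                   (simulate-complete p))
  where
  late : Eventually (n <_)
  late = suc n , λ _ n<N → n<N
  combine : ∀ {N} → n < N →
            (∀ m → m < n → ∃ λ v → simulate c (applyUpTo g N , ⟨ x , m ⟩) ≡ 2 + v) ×
            simulate c (applyUpTo g N , ⟨ x , n ⟩) ≡ 1 →
            pred (search c (applyUpTo g N , x) (encodeStr (applyUpTo g N))) ≡ suc n
  combine {N} n<N (b , a) = cong pred (search-found c (applyUpTo g N) x n _
    (<-≤-trans (subst (n <_) (sym (length-applyUpTo g N)) n<N) (length≤encode (applyUpTo g N))) b a)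

-- Prefixes

⊑-refl : ∀ {σ} → σ ⊑ σ
⊑-refl {[]}    = []
⊑-refl {a ∷ σ} = refl ∷ ⊑-refl

⊑-trans : ∀ {ρ σ τ} → ρ ⊑ σ → σ ⊑ τ → ρ ⊑ τ
⊑-trans []         q          = []
⊑-trans (refl ∷ p) (refl ∷ q) = refl ∷ ⊑-trans p q

⊑-++ : ∀ σ {τ} → σ ⊑ σ ++ τ
⊑-++ []      = []
⊑-++ (a ∷ σ) = refl ∷ ⊑-++ σ

drop-⊑ : ∀ {n σ τ a ρ} → σ ⊑ τ → drop n σ ≡ a ∷ ρ → ∃ λ ρ′ → drop n τ ≡ a ∷ ρ′
drop-⊑ {zero}  (refl ∷ _) refl = _ , refl
drop-⊑ {suc n} (refl ∷ p) q    = drop-⊑ {n} p q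

drop-cons⇒< : ∀ n (σ : Str) {a ρ} → drop n σ ≡ a ∷ ρ → n < length σ
drop-cons⇒< zero    (_ ∷ _) p = s≤s z≤n
drop-cons⇒< (suc n) (_ ∷ σ) p = s≤s (drop-cons⇒< n σ p)

<⇒drop-cons : ∀ {n} σ → n < length σ → ∃ λ ρ → drop n σ ≡ at σ n ∷ ρ
<⇒drop-cons {zero}  (_ ∷ _) _       = _ , refl
<⇒drop-cons {suc n} (_ ∷ σ) (s≤s p) = <⇒drop-cons σ p

applyUpTo-mono : ∀ (f : Baire) {m n} → m ≤ n → applyUpTo f m ⊑ applyUpTo f n
applyUpTo-mono f z≤n     = []
applyUpTo-mono f (s≤s p) = refl ∷ applyUpTo-mono (f ∘ suc) p

applyUpTo-cong : ∀ (f h : Baire) n → (∀ i → i < n → f i ≡ h i) → applyUpTo f n ≡ applyUpTo h n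
applyUpTo-cong f h zero    p = refl
applyUpTo-cong f h (suc n) p = cong₂ _∷_ (p 0 (s≤s z≤n)) (applyUpTo-cong _ _ n λ i i<n → p (suc i) (s≤s i<n))

applyUpTo-at : ∀ σ n → n ≤ length σ → applyUpTo (at σ) n ⊑ σ
applyUpTo-at σ       zero    _       = []
applyUpTo-at (a ∷ σ) (suc n) (s≤s p) = refl ∷ applyUpTo-at σ n p

at-⊑ : ∀ {σ τ n} → σ ⊑ τ → n < length σ → at τ n ≡ at σ n
at-⊑ {σ} {n = n} p n<σ = cong hd (proj₂ (drop-⊑ {n} p (proj₂ (<⇒drop-cons σ n<σ))))

applyUpTo⊑⇒at : ∀ (f : Baire) {σ m n} → m < n → applyUpTo f n ⊑ σ → m < length σ × at σ m ≡ f m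
applyUpTo⊑⇒at f {σ} {m} m<n p =
  let _ , q = drop-⊑ {m} p (proj₂ (drop-applyUpTo f m<n))
  in drop-cons⇒< m σ q , cong hd q

-- Each step appends at least one letter, so `c n` has length at least `n` and the letter at `i` is
-- settled in `c (suc i)`.
increasing-limit : (c : ℕ → Str) → (∀ n → ∃ λ w → ∃ λ a → c (suc n) ≡ c n ++ (w ∷ʳ a)) →
                   ∀ n → applyUpTo (λ i → at (c (suc i)) i) n ⊑ c n
increasing-limit c grow n = subst (_⊑ c n)
  (applyUpTo-cong (at (c n)) _ n λ i i<n → at-⊑ (mono i<n) (long (suc i)))
  (applyUpTo-at (c n) n (long n))
  where
  long : ∀ n → n ≤ length (c n)
  long zero    = z≤n
  long (suc n) with w , a , p ← grow n = begin
    suc n                           ≤⟨ s≤s (long n) ⟩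
    suc (length (c n))              ≤⟨ s≤s (m≤m+n _ (length w)) ⟩
    suc (length (c n) + length w)   ≡⟨ +-suc (length (c n)) (length w) ⟨
    length (c n) + suc (length w)   ≡⟨ cong (length (c n) +_) (trans (+-comm 1 (length w)) (sym (length-++ w))) ⟩
    length (c n) + length (w ∷ʳ a)  ≡⟨ length-++ (c n) ⟨
    length (c n ++ (w ∷ʳ a))        ≡⟨ cong length p ⟨
    length (c (suc n))              ∎
    where open ≤-Reasoning
  mono : ∀ {m n} → m ≤ n → c m ⊑ c n
  mono {n = zero}  z≤n = ⊑-refl
  mono {n = suc n} m≤1+n with m≤n⇒m<n∨m≡n m≤1+n
  ... | inj₁ (s≤s m≤n) with w , a , p ← grow n = ⊑-trans (mono m≤n) (subst (c n ⊑_) (sym p) (⊑-++ (c n)))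
  ... | inj₂ refl      = ⊑-refl

infixr 5 _⌢_

_⌢_ : Str → Baire → Baire
([]      ⌢ f) n       = f n
((a ∷ σ) ⌢ f) zero    = a
((a ∷ σ) ⌢ f) (suc n) = (σ ⌢ f) n

-- Two lengths are used because each letter of `σ` lowers `m` in the induction but leaves `n` alone.
applyUpTo-⌢ : ∀ σ f {m n} → m ≤ n → applyUpTo (σ ⌢ f) m ⊑ σ ++ applyUpTo f n
applyUpTo-⌢ []      f p       = applyUpTo-mono f p
applyUpTo-⌢ (a ∷ σ) f z≤n     = []
applyUpTo-⌢ (a ∷ σ) f (s≤s p) = refl ∷ applyUpTo-⌢ σ f (m≤n⇒m≤1+n p)

⌢-agrees : ∀ σ f → Agrees (σ ⌢ f) σ
⌢-agrees (a ∷ σ) f zero    refl = refl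
⌢-agrees (a ∷ σ) f (suc n) p   = ⌢-agrees σ f n p

⌢-at : ∀ σ f n → encodeStr (drop n σ) ≢ 0 → (σ ⌢ f) n ≡ at σ n
⌢-at []      f zero    p = contradiction refl p
⌢-at []      f (suc n) p = contradiction refl p
⌢-at (a ∷ σ) f zero    p = refl
⌢-at (a ∷ σ) f (suc n) p = ⌢-at σ f n p

agrees-⊑ : ∀ {f σ τ} → σ ⊑ τ → Agrees f τ → Agrees f σ
agrees-⊑ p ag n q = ag n (proj₂ (drop-⊑ {n} p q))

-- Diagonally noncomputable functions

Φ-functional : ∀ {e n v w} → Φ e n v → Φ e n w → v ≡ w
Φ-functional (c , refl , p) (d , q , r) with encode-injective d c q
... | refl = deterministic p r

-- Unfolding the index would compute an astronomically large number.
opaque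
  diagonal-index : {f : Baire → ℕ → ℕ} → Computable {nat} {nat} f → ∃ λ e → Φ e e (f (λ _ → 0) e)
  diagonal-index F = encode (code F) , code F , refl , halts F _ _

_[_≔_] : Baire → ℕ → ℕ → Baire
(f [ n ≔ a ]) i with i ≟ n
... | yes _ = a
... | no  _ = f i

update-same : ∀ f n {a} → (f [ n ≔ a ]) n ≡ a
update-same f n with n ≟ n
... | yes _  = refl
... | no n≢n = contradiction refl n≢n

update-below : ∀ f {n a} i → i < n → (f [ n ≔ a ]) i ≡ f i
update-below f {n} i i<n with i ≟ n
... | yes refl = contradiction i<n (<-irrefl refl)
... | no _     = refl

update-DNR : ∀ {k f n a} → f ∈ DNR k → a < k → ¬ Φ n n a → f [ n ≔ a ] ∈ DNR k
update-DNR {k} {f} {n} {a} (bdd , avoids) a<k ¬Φ = bdd′ , avoids′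
  where
  bdd′ : ∀ i → (f [ n ≔ a ]) i < k
  bdd′ i with i ≟ n
  ... | yes _ = a<k
  ... | no  _ = bdd i
  avoids′ : ∀ e v → Φ e e v → (f [ n ≔ a ]) e ≢ v
  avoids′ e v p q with e ≟ n
  ... | no  _    = avoids e v p q
  avoids′ e v p refl | yes refl = ¬Φ p

Unbounded : Pred Str 0ℓ → Set
Unbounded S = ∀ n → ∃ λ σ → σ ∈ S × n ≤ length σ

-- Classical tools: a diagonally noncomputable function and König's lemma.

module Classical (em : ExcludedMiddle 0ℓ) where

  classically : {P : Set} → ¬ ¬ P → P
  classically = decidable-stable em

  ¬∀⇒∃¬ : {X : Set} {P : X → Set} → ¬ (∀ x → P x) → ∃ λ x → ¬ P x
  ¬∀⇒∃¬ p = classically λ q → p λ x → classically λ r → q (x , r)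

  -- Two values suffice: 1 where the diagonal value is 0, and 0 elsewhere.
  DNR-nonempty : ∀ {k} → 2 ≤ k → ∃ λ f → f ∈ DNR k
  DNR-nonempty {k} 2≤k = f , bdd , avoids
    where
    f : Baire
    f e with em {Φ e e 0}
    ... | yes _ = 1
    ... | no  _ = 0
    bdd : ∀ e → f e < k
    bdd e with em {Φ e e 0}
    ... | yes _ = 2≤k
    ... | no  _ = ≤-trans (s≤s z≤n) 2≤k
    avoids : ∀ e v → Φ e e v → f e ≢ v
    avoids e v p q with em {Φ e e 0}
    avoids e v p refl | yes r = contradiction (Φ-functional r p) λ ()
    avoids e v p refl | no ¬r = ¬r p

  module _ {k : ℕ} where

    -- Pigeonhole: if the strings after each of the `k` possible first letters had bounded length, a
    -- common bound, plus one for the first letter, would bound `S`.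
    unbounded-child : ∀ {S} → S ⊆ All (_< k) → Unbounded S → ∃ λ a → Unbounded (λ σ → a ∷ σ ∈ S)
    unbounded-child {S} bdd unb = classically λ none →
      let N , short = eventually-below k λ a _ →
            let n , p = ¬∀⇒∃¬ λ u → none (a , u)
            in n , λ m n≤m σ aσ∈S → ≰⇒> λ m≤σ → p (σ , aσ∈S , ≤-trans n≤m m≤σ)
      in refute N (short N ≤-refl) (unb (suc N))
      where
      refute : ∀ N → (∀ a → a < k → ∀ σ → a ∷ σ ∈ S → length σ < N) → ¬ (∃ λ σ → σ ∈ S × suc N ≤ length σ)
      refute N short (a ∷ σ , aσ∈S , s≤s N≤σ) with bdd aσ∈S
      ... | a<k ∷ _ = <⇒≱ (short a a<k σ aσ∈S) N≤σ

    branch : ∀ {S} → S ⊆ All (_< k) → Unbounded S → Baire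
    branch bdd unb zero    = proj₁ (unbounded-child bdd unb)
    branch bdd unb (suc n) = branch (λ p → All.tail (bdd p)) (proj₂ (unbounded-child bdd unb)) n

    branch-prefix : ∀ {S} (bdd : S ⊆ All (_< k)) (unb : Unbounded S) →
                    ∀ n → ∃ λ σ → σ ∈ S × applyUpTo (branch bdd unb) n ⊑ σ
    branch-prefix bdd unb zero    = let σ , p , _ = unb 0 in σ , p , []
    branch-prefix bdd unb (suc n) =
      let a , u     = unbounded-child bdd unb
          σ , p , q = branch-prefix (λ p → All.tail (bdd p)) u n
      in a ∷ σ , p , refl ∷ q

    -- `S` is an arbitrary set of strings, so the initial segments of `f` are only known to extend
    -- to members of `S`.
    könig : ∀ {S} → S ⊆ All (_< k) → Unbounded S → ∃ λ f → ∀ n → ∃ λ σ → σ ∈ S × applyUpTo f n ⊑ σ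
    könig bdd unb = branch bdd unb , branch-prefix bdd unb

  -- The tree of `DNR k` and its leaves.

  module Tree {k : ℕ} (2≤k : 2 ≤ k) (D : TreeFor k (DNR k)) where

    open TreeFor D using (bounded; prefixClosed; computable; paths)

    χ : Str → ℕ
    χ = proj₁ (member computable)

    χᶠ : Computable {str} {nat} (λ _ → χ)
    χᶠ = proj₁ (proj₂ (member computable))

    χ-complete : ∀ {σ} → σ ∈ T D → χ σ ≡ 0
    χ-complete = proj₁ (proj₂ (proj₂ (member computable))) _

    χ-sound : ∀ {σ} → χ σ ≡ 0 → σ ∈ T D
    χ-sound = proj₂ (proj₂ (proj₂ (member computable))) _

    f₀ : Baire
    f₀ = proj₁ (DNR-nonempty 2≤k)

    f₀∈DNR : f₀ ∈ DNR k
    f₀∈DNR = proj₂ (DNR-nonempty 2≤k)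

    initial : ∀ {f} → f ∈ DNR k → ∀ n → applyUpTo f n ∈ T D
    initial = proj₂ paths

    path : ∀ {f} → (∀ n → ∃ λ σ → σ ∈ T D × applyUpTo f n ⊑ σ) → f ∈ DNR k
    path p = proj₁ paths λ n → let _ , q , r = p n in prefixClosed r q

    -- With no leaf above `σ`, every string of the tree above `σ` can be prolonged by one more
    -- letter.
    unbounded-above : ∀ σ → σ ∈ T D → (∀ τ → σ ++ τ ∉ Leaves (T D)) → Unbounded (λ τ → σ ++ τ ∈ T D)
    unbounded-above σ σ∈T none zero    = [] , subst (_∈ T D) (sym (++-identityʳ σ)) σ∈T , z≤n
    unbounded-above σ σ∈T none (suc n) =
      let τ , p , q = unbounded-above σ σ∈T none n
          a , r     = classically λ ¬a → none τ (p , λ a r → ¬a (a , r))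
      in τ ∷ʳ a , subst (_∈ T D) (++-assoc σ τ [ a ]) r ,
         subst (suc n ≤_) (sym (trans (length-++ τ) (+-comm (length τ) 1))) (s≤s q)

    leafless-DNR : ∀ σ → σ ∈ T D → (∀ τ → σ ++ τ ∉ Leaves (T D)) → ∃ λ f → σ ⌢ f ∈ DNR k
    leafless-DNR σ σ∈T none = f , path λ n → let τ , p , q = f-prefix n in
        σ ++ τ , p , ⊑-trans (applyUpTo-⌢ σ f (≤-refl {n})) (++-⊑ σ q)
      where
      f∃ = könig {k} (λ p → All.++⁻ʳ σ (bounded p)) (unbounded-above σ σ∈T none)
      f = proj₁ f∃
      f-prefix = proj₂ f∃
      ++-⊑ : ∀ σ {τ τ′} → τ ⊑ τ′ → σ ++ τ ⊑ σ ++ τ′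
      ++-⊑ []      p = p
      ++-⊑ (a ∷ σ) p = refl ∷ ++-⊑ σ p

    -- Otherwise there would be a computable choice of values e ↦ σₑ(e) with
    -- each σₑ extendible in the tree.
    opaque
      leaf-above : ∀ σ → σ ∈ T D → ∃ λ τ → σ ++ τ ∈ Leaves (T D)
      leaf-above σ σ∈T = classically λ none → leafless (λ τ p → none (τ , p))
        where
        module _ (none : ∀ τ → σ ++ τ ∉ Leaves (T D)) where
          long : Computable {nat ⊗ str} {nat} (λ _ (n , τ) → χ (σ ++ τ) + not (encodeStr (drop n (σ ++ τ))))
          long = +ᶠ ∘ᶠ (χᶠ ∘ᶠ str′ ,ᶠ notᶠ ∘ᶠ encodeᶠ {str} ∘ᶠ dropᶠ ∘ᶠ (str′ ,ᶠ fstᶠ))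
            where
            str′ = ++ᶠ ∘ᶠ (constᶠ {A = nat ⊗ str} σ ,ᶠ sndᶠ)
          total : (g : Baire) (n : ℕ) → ∃ λ τ → χ (σ ++ τ) + not (encodeStr (drop n (σ ++ τ))) ≡ 0
          total _ n =
            let τ , p , n<τ = unbounded-above σ σ∈T none (suc n)
                _ , q = <⇒drop-cons (σ ++ τ)
                      (≤-trans n<τ (≤-trans (m≤n+m _ (length σ)) (≤-reflexive (sym (length-++ σ)))))
            in τ , cong₂ _+_ (χ-complete p)
                     (not-true λ r → contradiction (trans (cong encodeStr (sym q)) r) λ ())
          found = searchᶠ {A = nat} {B = str} long total
          ρ : ℕ → Str
          ρ n = σ ++ proj₁ found (λ _ → 0) n
          value : Computable {nat} {nat} (λ g n → at (σ ++ proj₁ found g n) n)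
          value = atᶠ ∘ᶠ (++ᶠ ∘ᶠ (constᶠ σ ,ᶠ proj₁ (proj₂ found)) ,ᶠ idᶠ)
          e = proj₁ (diagonal-index value)
          ρ-spec : χ (ρ e) + not (encodeStr (drop e (ρ e))) ≡ 0
          ρ-spec = proj₂ (proj₂ found) _ e
          leafless : ⊥
          leafless =
            -- As `e` is an index of `value`, Φₑ(e) is the letter of `ρ e` at `e`. No leaf lies
            -- above `ρ e` either, so `ρ e` begins an element of `DNR k`, which then takes the
            -- forbidden value at `e`.
            let f , _ , avoids = leafless-DNR (ρ e) (χ-sound (m+n≡0⇒m≡0 (χ (ρ e)) ρ-spec))
                                   (λ τ p → none _ (subst (_∈ Leaves (T D)) (++-assoc σ _ τ) p))
            in avoids e _ (proj₂ (diagonal-index value))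
                 (⌢-at (ρ e) f e (not-false (m+n≡0⇒n≡0 (χ (ρ e)) ρ-spec)))

    -- Strictness of the reduction.

    above : ∀ σ → σ ∈ T D → ∃ λ f → f ∈ (D ▼ D) × Agrees f σ
    above σ σ∈T =
      let τ , leaf = leaf-above σ σ∈T
          ρ        = (σ ++ τ) ∷ʳ f₀ 0
      in ρ ⌢ f₀ ,
         -- A single completed block: the leaf, then the letter `f₀ 0`, which as a string of length
         -- 1 lies in the outer tree. The fresh inner copy after it follows `f₀` from its beginning.
         (λ n → [ (σ ++ τ , f₀ 0) ] , applyUpTo f₀ n , initial f₀∈DNR 1 , leaf ∷ [] , initial f₀∈DNR n ,
                subst (λ ρ′ → applyUpTo (ρ ⌢ f₀) n ⊑ ρ′ ++ applyUpTo f₀ n) (sym (++-identityʳ ρ))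
                      (applyUpTo-⌢ ρ f₀ ≤-refl)) ,
         agrees-⊑ {σ = σ} {ρ} (⊑-trans (⊑-++ σ) (⊑-++ (σ ++ τ))) (⌢-agrees ρ f₀)

    DNR⊆▼ : DNR k ⊆ (D ▼ D)
    DNR⊆▼ {f} p n = [] , applyUpTo f n , initial p 0 , [] , initial p n , ⊑-refl

    -- Searching for a string of the tree on which `c` halts on `n` makes the output a computable
    -- function of `n`; `e` is an index of this function.
    diagonal-run : ∀ c → (∀ n → ∃ λ σ → σ ∈ T D × simulate c (σ , n) ≢ 0) →
                   ∃ λ e → ∃ λ σ → ∃ λ v → σ ∈ T D × simulate c (σ , e) ≡ suc v × Φ e e v
    diagonal-run c halting =
      e , ρ , pred (simulate c (ρ , e)) , χ-sound (m+n≡0⇒m≡0 (χ ρ) ρ-spec) ,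
      sym (suc-pred (simulate c (ρ , e)) ⦃ ≢-nonZero (not-false (m+n≡0⇒n≡0 (χ ρ) ρ-spec)) ⦄) ,
      proj₂ (diagonal-index output)
      where
      test : Computable {nat ⊗ str} {nat} (λ _ (n , σ) → χ σ + not (simulate c (σ , n)))
      test = +ᶠ ∘ᶠ (χᶠ ∘ᶠ sndᶠ ,ᶠ notᶠ ∘ᶠ simulateᶠ c ∘ᶠ (sndᶠ ,ᶠ fstᶠ))
      total : (g : Baire) (n : ℕ) → ∃ λ σ → χ σ + not (simulate c (σ , n)) ≡ 0
      total _ n = let σ , p , q = halting n in σ , cong₂ _+_ (χ-complete p) (not-true q)
      found = searchᶠ {A = nat} {B = str} test total
      σ : Baire → ℕ → Str
      σ = proj₁ found
      output : Computable {nat} {nat} (λ g n → pred (simulate c (σ g n , n)))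
      output = predᶠ ∘ᶠ simulateᶠ c ∘ᶠ (proj₁ (proj₂ found) ,ᶠ idᶠ)
      e : ℕ
      e = proj₁ (diagonal-index output)
      ρ : Str
      ρ = σ (λ _ → 0) e
      ρ-spec : χ ρ + not (simulate c (ρ , e)) ≡ 0
      ρ-spec = proj₂ (proj₂ found) (λ _ → 0) e

    DNR≰▼ : ∀ m → ¬ (DNR m ≤¹₁ (D ▼ D))
    DNR≰▼ m (c , reduces) =
      -- The search always succeeds: `f₀` lies in `D ▼ D`, so `c` is total on it and each of its
      -- runs is completed within some initial segment.
      let e , σ , v , σ∈T , halt , Φv = diagonal-run c λ n →
            let h , p , _ = reduces f₀ (DNR⊆▼ f₀∈DNR)
                N , q     = simulate-complete (p n)
            in applyUpTo f₀ N , initial f₀∈DNR N , λ r → contradiction (trans (sym (q N ≤-refl)) r) λ ()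
          -- Even if `σ` has no infinite extension in the tree, it begins an element of `D ▼ D`, for
          -- which `c` outputs the diagonal value `v` at `e`.
          f , f∈▼ , agrees        = above σ σ∈T
          h , runs , _ , avoids   = reduces f f∈▼
      in avoids e v Φv (deterministic (runs e) (simulate-sound c agrees halt))

    -- Deciding that Φₑ(e) = v

    opaque
      decodeString : ℕ → Str
      decodeString n = proj₁ (⌜⌝-surjective str n)

      decodeStringᶠ : Computable {nat} {str} (λ _ → decodeString)
      decodeStringᶠ = decodeᶠ

      decode-encodeStr : ∀ σ → decodeString (encodeStr σ) ≡ σ
      decode-encodeStr σ = encodeStr-injective _ σ (proj₂ (⌜⌝-surjective str (encodeStr σ)))

    excludes : Str → ℕ × ℕ × ℕ → ℕ
    excludes σ (e , v , n) = χ σ ⇒ not (encodeStr (drop n σ)) ⇒ not (equal (at σ e) v)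

    excludesᶠ : Computable {str ⊗ nat ⊗ nat ⊗ nat} {nat} (λ _ (σ , p) → excludes σ p)
    excludesᶠ = ⇒ᶠ ∘ᶠ (χᶠ ∘ᶠ fstᶠ ,ᶠ
      ⇒ᶠ ∘ᶠ (notᶠ ∘ᶠ encodeᶠ {str} ∘ᶠ dropᶠ ∘ᶠ (fstᶠ ,ᶠ sndᶠ ∘ᶠ sndᶠ ∘ᶠ sndᶠ) ,ᶠ
             notᶠ ∘ᶠ equalᶠ ∘ᶠ (atᶠ ∘ᶠ (fstᶠ ,ᶠ fstᶠ ∘ᶠ sndᶠ) ,ᶠ fstᶠ ∘ᶠ sndᶠ ∘ᶠ sndᶠ)))

    excludes-intro : ∀ σ {e v n} → (σ ∈ T D → n < length σ → at σ e ≢ v) → excludes σ (e , v , n) ≡ 0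
    excludes-intro σ {e} {v} {n} p = ⇒-intro (χ σ) λ χσ → ⇒-intro (not (encodeStr (drop n σ))) λ long →
      not-true λ q → p (χ-sound χσ) (drop-nonempty n σ (not-false long)) (equal⇒≡ q)
      where
      drop-nonempty : ∀ n σ → encodeStr (drop n σ) ≢ 0 → n < length σ
      drop-nonempty zero    []      p = contradiction refl p
      drop-nonempty (suc n) []      p = contradiction refl p
      drop-nonempty zero    (a ∷ σ) p = s≤s z≤n
      drop-nonempty (suc n) (a ∷ σ) p = s≤s (drop-nonempty n σ p)

    excludes-elim : ∀ σ {e v n} → excludes σ (e , v , n) ≡ 0 → σ ∈ T D → n < length σ → at σ e ≢ v
    excludes-elim σ {e} {v} {n} p σ∈T n<σ σe≡v = not-false
      (⇒-elim {not (encodeStr (drop n σ))} (⇒-elim {χ σ} p (χ-complete σ∈T))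
              (not-true λ q → contradiction (trans (sym (cong encodeStr (proj₂ (<⇒drop-cons σ n<σ)))) q) λ ()))
      (subst (λ w → equal (at σ e) w ≡ 0) σe≡v (equal-refl (at σ e)))

    opaque
      -- The codes of the strings of length suc n over k are bounded by that of kⁿ⁺¹.
      certifies : ℕ × ℕ × ℕ → ℕ
      certifies (e , v , n) =
        -- The first summand demands `e ≤ n`, so that the strings longer than `n` do have a letter
        -- at `e`.
        (e ∸ n) + ∑ (λ i → excludes (decodeString i) (e , v , n)) (suc (encodeStr (replicate (suc n) k)))

      certifiesᶠ : Computable {nat ⊗ nat ⊗ nat} {nat} (λ _ → certifies)
      certifiesᶠ = +ᶠ ∘ᶠ (∸ᶠ ∘ᶠ (fstᶠ {nat} {nat ⊗ nat} ,ᶠ n) ,ᶠ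
        sumᶠ ∘ᶠ (idᶠ ,ᶠ sucᶠ ∘ᶠ encodeᶠ {str} ∘ᶠ replicateᶠ k ∘ᶠ sucᶠ ∘ᶠ n))
        where
        n : Computable {nat ⊗ nat ⊗ nat} {nat} (λ _ (e , v , n) → n)
        n = sndᶠ {nat} ∘ᶠ sndᶠ {nat}
        sumᶠ : Computable {(nat ⊗ nat ⊗ nat) ⊗ nat} {nat} (λ _ (p , b) → ∑ (λ i → excludes (decodeString i) p) b)
        sumᶠ = ∑ᶠ (excludesᶠ ∘ᶠ (decodeStringᶠ ∘ᶠ sndᶠ ,ᶠ fstᶠ))

      encode-bound : ∀ f n → (∀ i → f i < k) → encodeStr (applyUpTo f n) ≤ encodeStr (replicate n k)
      encode-bound f zero    p = z≤n
      encode-bound f (suc n) p = s≤s (pair-mono (<⇒≤ (p 0)) (encode-bound (f ∘ suc) n (p ∘ suc)))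

      -- If Φₑ(e) were not `v`, changing `f₀` to `v` at `e` would keep it in `DNR k`; its initial
      -- segment of length `suc n` would be a string of the tree that the certificate excludes.
      certifies-sound : ∀ {e v n} → v < k → certifies (e , v , n) ≡ 0 → Φ e e v
      certifies-sound {e} {v} {n} v<k p = classically λ ¬Φ →
        let f     = f₀ [ e ≔ v ]
            f∈DNR = update-DNR f₀∈DNR v<k ¬Φ
            σ     = applyUpTo f (suc n)
            e≤n   = m∸n≡0⇒m≤n (m+n≡0⇒m≡0 (e ∸ n) p)
            σ-excluded : excludes σ (e , v , n) ≡ 0
            σ-excluded = subst (λ τ → excludes τ (e , v , n) ≡ 0)
              (decode-encodeStr σ)
              (∑≡0⁻¹ (λ i → excludes (decodeString i) (e , v , n)) (suc (encodeStr (replicate (suc n) k))) (m+n≡0⇒n≡0 (e ∸ n) p)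
                     (encodeStr σ) (s≤s (encode-bound f (suc n) (proj₁ f∈DNR))))
        in excludes-elim σ {e} {v} {n} σ-excluded (initial {f} f∈DNR (suc n))
             (subst (n <_) (sym (length-applyUpTo f (suc n))) ≤-refl)
             (trans (proj₂ (applyUpTo⊑⇒at f {σ} (s≤s e≤n) ⊑-refl)) (update-same f₀ e))

      -- Without a certificate, arbitrarily long strings of the tree have the letter `v` at `e`, and
      -- König's lemma turns them into an element of `DNR k` with the value Φₑ(e) at `e`.
      certifies-complete : ∀ {e v} → Φ e e v → ∃ λ n → certifies (e , v , n) ≡ 0
      certifies-complete {e} {v} Φv = classically λ none →
        let S = λ σ → σ ∈ T D × (e < length σ → at σ e ≡ v)
            unb : Unbounded S
            -- The bound `e + n` is at least `e`, as a certificate requires, and an unexcluded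
            -- string longer than it has length at least `n`.
            unb n = classically λ ¬S → none (e + n , cong₂ _+_ (m≤n⇒m∸n≡0 (m≤m+n e n))
              (∑≡0 (λ i → excludes (decodeString i) (e , v , e + n)) (suc (encodeStr (replicate (suc (e + n)) k)))
                 λ i _ → excludes-intro (decodeString i) {e} {v} {e + n} λ σ∈T long eq →
                ¬S (decodeString i , (σ∈T , λ _ → eq) , ≤-trans (m≤n+m n e) (<⇒≤ long))))
            f , p         = könig {k} {S} (λ s → bounded (proj₁ s)) unb
            _ , avoids    = path λ n → let σ , (σ∈T , _) , q = p n in σ , σ∈T , q
            σ , (_ , q) , f⊑σ = p (suc e)
            e<σ , r       = applyUpTo⊑⇒at f {σ} {e} ≤-refl f⊑σ
        in avoids e v Φv (trans (sym r) (q e<σ))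

    -- A bounded `f` that avoided all diagonal values would be a path and could not leave the tree.
    -- No bound on `e` is claimed.
    outside-conflict : ∀ f n → (∀ i → f i < k) → applyUpTo f n ∉ T D → ∃ λ e → Φ e e (f e)
    outside-conflict f n bdd outside = classically λ none →
      outside (initial {f} (bdd , λ e v p q → none (e , subst (Φ e e) (sym q) p)) n)

    -- Only letters below `k` are tried, since no others occur in the tree; this makes being a leaf
    -- decidable.
    isLeaf : Str → ℕ
    isLeaf σ = χ σ + ∑ (λ a → not (χ (σ ∷ʳ a))) k

    isLeafᶠ : Computable {str} {nat} (λ _ → isLeaf)
    isLeafᶠ = +ᶠ ∘ᶠ (χᶠ ,ᶠ ∑ᶠ (notᶠ ∘ᶠ χᶠ ∘ᶠ ∷ʳᶠ) ∘ᶠ (idᶠ ,ᶠ constᶠ k))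

    isLeaf-sound : ∀ {σ} → isLeaf σ ≡ 0 → σ ∈ Leaves (T D)
    isLeaf-sound {σ} p = χ-sound (m+n≡0⇒m≡0 (χ σ) p) , λ a σa∈T →
      not-false (∑≡0⁻¹ (λ a → not (χ (σ ∷ʳ a))) k (m+n≡0⇒n≡0 (χ σ) p) a (last-bound a (bounded σa∈T)))
                (χ-complete σa∈T)
      where
      last-bound : ∀ a → All (_< k) (σ ∷ʳ a) → a < k
      last-bound a p = All.head (All.++⁻ʳ σ p)

    isLeaf-complete : ∀ {σ} → σ ∈ Leaves (T D) → isLeaf σ ≡ 0
    isLeaf-complete {σ} (σ∈T , dead) = cong₂ _+_ (χ-complete σ∈T)
      (∑≡0 (λ a → not (χ (σ ∷ʳ a))) k λ a _ → not-true λ p → dead a (χ-sound p))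

    -- A number below k² is read as a pair of numbers below k.

    split : ℕ → ℕ × ℕ
    -- Division by `k` by counting up: `2 + r ∸ k` is 0 exactly if the remainder can still grow to
    -- `suc r` below `k`.
    split = natrec (0 , 0) λ _ (q , r) → if0 (2 + r ∸ k) (q , suc r) (suc q , 0)

    splitᶠ : Computable {nat} {nat ⊗ nat} (λ _ → split)
    splitᶠ = recᶠ {nat} (constᶠ (0 , 0))
      (if0ᶠ (∸ᶠ ∘ᶠ (sucᶠ ∘ᶠ sucᶠ ∘ᶠ r ,ᶠ constᶠ k)) (q ,ᶠ sucᶠ ∘ᶠ r) (sucᶠ ∘ᶠ q ,ᶠ constᶠ 0)
       ∘ᶠ sndᶠ ∘ᶠ sndᶠ)
      ∘ᶠ (idᶠ ,ᶠ idᶠ)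
      where
      q = fstᶠ {nat} {nat}
      r = sndᶠ {nat} {nat}

    split-spec : ∀ n → let q , r = split n in q * k + r ≡ n × r < k
    split-spec zero    = refl , ≤-trans (s≤s z≤n) 2≤k
    split-spec (suc n) =
      let q , r     = split n
          eq , r<k  = split-spec n
          0<k       = ≤-trans (s≤s z≤n) 2≤k
          full      = λ (nz : 2 + r ∸ k ≢ 0) → ≤-antisym (s≤s⁻¹ (≰⇒> {2 + r} {k} (nz ∘ m≤n⇒m∸n≡0))) r<k
      in if0-elim {X = ℕ × ℕ} (λ (q , r) → q * k + r ≡ suc n × r < k) (2 + r ∸ k) {q , suc r} {suc q , 0}
           (λ z → trans (+-suc (q * k) r) (cong suc eq) , m∸n≡0⇒m≤n {2 + r} z)
           (λ nz → (let open ≡-Reasoning in begin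
                      k + q * k + 0    ≡⟨ +-identityʳ (k + q * k) ⟩
                      k + q * k        ≡⟨ +-comm k (q * k) ⟩
                      q * k + k        ≡⟨ cong (q * k +_) (full nz) ⟩
                      q * k + suc r    ≡⟨ +-suc (q * k) r ⟩
                      suc (q * k + r)  ≡⟨ cong suc eq ⟩
                      suc n            ∎)
                   , 0<k)

    -- Numbers of the programs that pair two diagonal values.

    numIndex : ℕ → ℕ
    -- 6 is the tag of `compᶜ`.
    numIndex = natrec (encode zeroᶜ) λ _ u → ⟨ 6 , ⟨ encode succᶜ , u ⟩ ⟩

    numIndex-correct : ∀ n → numIndex n ≡ encode (num n)
    numIndex-correct zero    = refl
    numIndex-correct (suc n) = cong (λ u → ⟨ 6 , ⟨ encode succᶜ , u ⟩ ⟩) (numIndex-correct n)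

    numIndexᶠ : Computable {nat} {nat} (λ _ → numIndex)
    numIndexᶠ = recᶠ {nat} (constᶠ (encode zeroᶜ))
      (encodeᶠ {nat ⊗ nat ⊗ nat} ∘ᶠ (constᶠ 6 ,ᶠ constᶠ (encode succᶜ) ,ᶠ sndᶠ ∘ᶠ sndᶠ)) ∘ᶠ (idᶠ ,ᶠ idᶠ)

    opaque
      joinᶠ : Computable {nat ⊗ nat} {nat} (λ _ (q , r) → q * k + r)
      joinᶠ = +ᶠ ∘ᶠ (*ᶠ ∘ᶠ (fstᶠ ,ᶠ constᶠ k) ,ᶠ sndᶠ)

    Components : Ty
    Components = nat ⊗ nat ⊗ nat ⊗ (nat ⊗ nat ⊗ nat) ⊗ (nat ⊗ nat ⊗ nat)

    -- Tag 6 is composition and tag 5 pairing. The program's number is kept as a nested tuple, so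
    -- that `encodeᶠ` yields its computability.
    components : ℕ × ℕ → El Components
    components (d , e) = 6 , encode (code joinᶠ) , 5 , (6 , d , numIndex d) , (6 , e , numIndex e)

    componentsᶠ : Computable {nat ⊗ nat} {Components} (λ _ → components)
    componentsᶠ =
      constᶠ 6 ,ᶠ constᶠ (encode (code joinᶠ)) ,ᶠ constᶠ 5 ,ᶠ
      (constᶠ 6 ,ᶠ fstᶠ ,ᶠ numIndexᶠ ∘ᶠ fstᶠ) ,ᶠ (constᶠ 6 ,ᶠ sndᶠ ,ᶠ numIndexᶠ ∘ᶠ sndᶠ)

    opaque
      -- The number of the program running d and e on their own numbers and
      -- joining the outputs, in terms of the numbers of d and e.
      index : ℕ × ℕ → ℕ
      index p = ⌜_⌝ {Components} (components p)

      indexᶠ : Computable {nat ⊗ nat} {nat} (λ _ → index)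
      indexᶠ = encodeᶠ {Components} ∘ᶠ componentsᶠ

      index-Φ : ∀ {d e u v} → Φ d d u → Φ e e v → Φ (index (d , e)) (index (d , e)) (u * k + v)
      index-Φ {u = u} {v} (c , refl , p) (c′ , refl , q) =
        -- This program ignores its input, so it has the same output on its own number.
        compᶜ (code joinᶠ) (pairᶜ (compᶜ c (num (encode c))) (compᶜ c′ (num (encode c′)))) ,
        cong₂ (λ m n → ⟨ 6 , ⟨ encode (code joinᶠ) , ⟨ 5 , ⟨ ⟨ 6 , ⟨ encode c , m ⟩ ⟩ , ⟨ 6 , ⟨ encode c′ , n ⟩ ⟩ ⟩ ⟩ ⟩ ⟩)
              (sym (numIndex-correct (encode c))) (sym (numIndex-correct (encode c′))) ,
        comp⇓ (pair⇓ (comp⇓ (num⇓ (encode c)) p) (comp⇓ (num⇓ (encode c′)) q)) (halts joinᶠ _ (u , v))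

    -- For g ∈ DNR (k ^ 2), u g d e ≠ Φ_d(d) or v g d e ≠ Φ_e(e).
    opaque
      u v : Baire → ℕ × ℕ → ℕ
      u g p = proj₁ (split (g (index p)))
      v g p = proj₂ (split (g (index p)))

      uᶠ : Computable {nat ⊗ nat} {nat} u
      uᶠ = fstᶠ ∘ᶠ splitᶠ ∘ᶠ oracleᶠ ∘ᶠ indexᶠ

      vᶠ : Computable {nat ⊗ nat} {nat} v
      vᶠ = sndᶠ ∘ᶠ splitᶠ ∘ᶠ oracleᶠ ∘ᶠ indexᶠ

      v<k : ∀ g p → v g p < k
      v<k g p = proj₂ (split-spec (g (index p)))

      u<k : ∀ {g} → g ∈ DNR (k ^ 2) → ∀ p → u g p < k
      u<k {g} (bdd , _) p = *-cancelʳ-< k _ _ (≤-<-trans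
        (≤-trans (m≤m+n _ _) (≤-reflexive (proj₁ (split-spec (g (index p))))))
        (subst (g (index p) <_) (cong (k *_) (*-identityʳ k)) (bdd (index p))))

      u-avoids : ∀ {g d e} → g ∈ DNR (k ^ 2) → Φ e e (v g (d , e)) → ¬ Φ d d (u g (d , e))
      u-avoids {g} {d} {e} (_ , avoids) q p =
        avoids (index (d , e)) _ (index-Φ p q) (sym (proj₁ (split-spec (g (index (d , e))))))

    -- The stage (out , d , m) has completed d blocks, which form out, and is
    -- following the function v g (d , _), of which it has output m values.

    Stage : Ty
    Stage = str ⊗ nat ⊗ nat

    follow : Baire → ℕ × ℕ → Str
    follow g (d , m) = applyUpTo (λ e → v g (d , e)) m

    followᶠ : Computable {nat ⊗ nat} {str} follow
    followᶠ = applyUpToᶠ vᶠ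

    opaque
      -- The implication makes the search end even if the followed string is outside the tree, where
      -- every string passes the test.
      leafSearch : ∃ λ (τ : Baire → ℕ × ℕ → Str) → Computable {nat ⊗ nat} {str} τ ×
                   ∀ g p → (χ (follow g p) ⇒ isLeaf (follow g p ++ τ g p)) ≡ 0
      leafSearch = searchᶠ {nat ⊗ nat} {str}
        (⇒ᶠ ∘ᶠ (χᶠ ∘ᶠ followᶠ ∘ᶠ fstᶠ ,ᶠ isLeafᶠ ∘ᶠ ++ᶠ ∘ᶠ (followᶠ ∘ᶠ fstᶠ ,ᶠ sndᶠ)))
        λ g p → case em {follow g p ∈ T D} of λ where
          (yes σ∈T) → let τ , leaf = leaf-above _ σ∈T in τ , ⇒-intro (χ (follow g p)) λ _ → isLeaf-complete leaf
          (no σ∉T)  → [] , ⇒-intro (χ (follow g p)) λ q → contradiction (χ-sound q) σ∉T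

    -- A conflict at `e` with certificate `n` is demanded only if the next letter leaves the tree;
    -- otherwise any pair passes, so the search is total.
    conflictTest : Baire → (ℕ × ℕ) × (ℕ × ℕ) → ℕ
    conflictTest g ((d , m) , (e , n)) = not (χ (follow g (d , suc m))) ⇒ certifies (e , v g (d , e) , n)

    conflictTestᶠ : Computable {(nat ⊗ nat) ⊗ (nat ⊗ nat)} {nat} conflictTest
    conflictTestᶠ = ⇒ᶠ ∘ᶠ
      (notᶠ ∘ᶠ χᶠ ∘ᶠ followᶠ ∘ᶠ (fstᶠ ∘ᶠ p ,ᶠ sucᶠ ∘ᶠ sndᶠ ∘ᶠ p) ,ᶠ
       certifiesᶠ ∘ᶠ (fstᶠ ∘ᶠ q ,ᶠ vᶠ ∘ᶠ (fstᶠ ∘ᶠ p ,ᶠ fstᶠ ∘ᶠ q) ,ᶠ sndᶠ ∘ᶠ q))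
      where
      p = fstᶠ {nat ⊗ nat} {nat ⊗ nat}
      q = sndᶠ {nat ⊗ nat} {nat ⊗ nat}

    conflictTest-inside : ∀ g d m → follow g (d , suc m) ∈ T D → conflictTest g ((d , m) , (0 , 0)) ≡ 0
    conflictTest-inside g d m σ∈T = ⇒-intro (not (χ (follow g (d , suc m)))) λ left →
      contradiction (χ-complete σ∈T) (not-false left)

    conflictTest-outside : ∀ g d m → follow g (d , suc m) ∉ T D → ∃ λ q → conflictTest g ((d , m) , q) ≡ 0
    conflictTest-outside g d m σ∉T =
      let e , Φe   = outside-conflict (λ e → v g (d , e)) (suc m) (λ e → v<k g (d , e)) σ∉T
          n , cert = certifies-complete Φe
      in (e , n) , ⇒-intro (not (χ (follow g (d , suc m)))) λ _ → cert

    conflictTest-total : ∀ g p → ∃ λ q → conflictTest g (p , q) ≡ 0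
    conflictTest-total g (d , m) with em {follow g (d , suc m) ∈ T D}
    ... | yes σ∈T = (0 , 0) , conflictTest-inside g d m σ∈T
    ... | no  σ∉T = conflictTest-outside g d m σ∉T

    conflictSearch : ∃ λ (c : Baire → ℕ × ℕ → ℕ × ℕ) →
                     Computable {nat ⊗ nat} {nat ⊗ nat} c × ∀ g p → conflictTest g (p , c g p) ≡ 0
    conflictSearch = searchᶠ {nat ⊗ nat} {nat ⊗ nat} conflictTestᶠ conflictTest-total

    toLeaf : Baire → ℕ × ℕ → Str
    toLeaf = proj₁ leafSearch

    conflict : Baire → ℕ × ℕ → ℕ
    conflict g p = proj₁ (proj₁ conflictSearch g p)

    toLeaf-spec : ∀ g p → follow g p ∈ T D → follow g p ++ toLeaf g p ∈ Leaves (T D)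
    toLeaf-spec g p σ∈T = isLeaf-sound (⇒-elim {χ (follow g p)} (proj₂ (proj₂ leafSearch) g p) (χ-complete σ∈T))

    conflict-spec : ∀ g d m → χ (follow g (d , suc m)) ≢ 0 →
                    let e = conflict g (d , m) in Φ e e (v g (d , e))
    conflict-spec g d m left = certifies-sound (v<k g _)
      (⇒-elim {not (χ (follow g (d , suc m)))} (proj₂ (proj₂ conflictSearch) g (d , m)) (not-true left))

    block : Baire → ℕ × ℕ → Str × ℕ
    block g (d , m) = follow g (d , m) ++ toLeaf g (d , m) , u g (d , conflict g (d , m))

    advance : Baire → El Stage → El Stage
    advance g (out , d , m) =
      if0 (χ (follow g (d , suc m)))
          (out , d , suc m)
          (out ++ uncurry _∷ʳ_ (block g (d , m)) , suc d , 0)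

    advanceᶠ : Computable {Stage} {Stage} advance
    advanceᶠ = if0ᶠ (χᶠ ∘ᶠ followᶠ ∘ᶠ (d ,ᶠ sucᶠ ∘ᶠ m)) (out ,ᶠ d ,ᶠ sucᶠ ∘ᶠ m)
      (++ᶠ ∘ᶠ (out ,ᶠ ∷ʳᶠ ∘ᶠ (++ᶠ ∘ᶠ (followᶠ ∘ᶠ sndᶠ ,ᶠ proj₁ (proj₂ leafSearch) ∘ᶠ sndᶠ) ,ᶠ
                              uᶠ ∘ᶠ (d ,ᶠ fstᶠ ∘ᶠ proj₁ (proj₂ conflictSearch) ∘ᶠ sndᶠ)))
       ,ᶠ sucᶠ ∘ᶠ d ,ᶠ constᶠ 0)
      where
      out = fstᶠ {str} {nat ⊗ nat}
      d   = fstᶠ {nat} {nat} ∘ᶠ sndᶠ {str} {nat ⊗ nat}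
      m   = sndᶠ {nat} {nat} ∘ᶠ sndᶠ {str} {nat ⊗ nat}

    stage : Baire → ℕ → El Stage
    stage g = natrec ([] , 0 , 0) λ _ → advance g

    output : Baire → El Stage → Str
    output g (out , p) = out ++ follow g p

    limit : Baire → Baire
    limit g n = at (output g (stage g (suc n))) n

    limitᶠ : Computable {nat} {nat} limit
    limitᶠ = atᶠ ∘ᶠ (++ᶠ ∘ᶠ (fstᶠ ,ᶠ followᶠ ∘ᶠ sndᶠ) ∘ᶠ stageᶠ ∘ᶠ sucᶠ ,ᶠ idᶠ)
      where
      stageᶠ : Computable {nat} {Stage} stage
      stageᶠ = recᶠ {nat} {Stage} (constᶠ ([] , 0 , 0)) (advanceᶠ ∘ᶠ sndᶠ ∘ᶠ sndᶠ) ∘ᶠ (idᶠ ,ᶠ idᶠ)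

    -- The construction yields an element of the hyperconcatenation.

    advance-extends : ∀ g s → ∃ λ w → ∃ λ a → output g (advance g s) ≡ output g s ++ (w ∷ʳ a)
    advance-extends g (out , d , m) = if0-elim
      (λ s → ∃ λ w → ∃ λ a → output g s ≡ (out ++ follow g (d , m)) ++ (w ∷ʳ a))
      (χ (follow g (d , suc m)))
      (λ _ → [] , v g (d , m) ,
             trans (cong (out ++_) (sym (applyUpTo-∷ʳ (λ e → v g (d , e)) m))) (sym (++-assoc out _ _)))
      (λ _ → toLeaf g (d , m) , u g (d , conflict g (d , m)) ,
             trans (++-identityʳ _) (trans (cong (out ++_) (++-assoc (follow g (d , m)) _ _)) (sym (++-assoc out _ _))))

    limit-prefix : ∀ g n → applyUpTo (limit g) n ⊑ output g (stage g n)
    limit-prefix g = increasing-limit (λ n → output g (stage g n)) λ n → advance-extends g (stage g n)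

    -- The letters closing the blocks are required to begin a whole element `f` of `DNR k`, because
    -- this is what puts them in the outer tree.
    Invariant : Baire → El Stage → Set
    Invariant g (out , d , m) =
      follow g (d , m) ∈ T D ×
      ∃ λ (blocks : List (Str × ℕ)) → ∃ λ f →
        flatten blocks ≡ out × All (Leaves (T D)) (map proj₁ blocks) ×
        map proj₂ blocks ≡ applyUpTo f d × f ∈ DNR k

    advance-invariant : ∀ {g} → g ∈ DNR (k ^ 2) → ∀ s → Invariant g s → Invariant g (advance g s)
    advance-invariant {g} g∈DNR (out , d , m) (σ∈T , blocks , f , flat , leaves , values , f∈DNR) =
      if0-elim (Invariant g) (χ (follow g (d , suc m)))
        (λ stays → χ-sound stays , blocks , f , flat , leaves , values , f∈DNR)
        -- When a block closes, `f` changes at `d` alone, to a value that the conflict makes safe.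
        -- The letters output before are its values below `d` and stay.
        (λ left → let ρ , a = block g (d , m) in
          initial f∈DNR 0 , blocks ∷ʳ (ρ , a) , f [ d ≔ a ] ,
          trans (concatMap-++ _ blocks _) (cong₂ _++_ flat (++-identityʳ (ρ ∷ʳ a))) ,
          subst (All (Leaves (T D))) (sym (map-++ proj₁ blocks _)) (All.++⁺ leaves (toLeaf-spec g (d , m) σ∈T ∷ [])) ,
          trans (map-++ proj₂ blocks _) (trans
            (cong₂ (λ σ a → σ ∷ʳ a)
              (trans values (sym (applyUpTo-cong (f [ d ≔ a ]) f d (update-below f))))
              (sym (update-same f d)))
            (applyUpTo-∷ʳ (f [ d ≔ a ]) d)) ,
          update-DNR f∈DNR (u<k g∈DNR _) (u-avoids g∈DNR (conflict-spec g d m left)))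

    stage-invariant : ∀ {g} → g ∈ DNR (k ^ 2) → ∀ n → Invariant g (stage g n)
    stage-invariant g∈DNR zero    = initial f₀∈DNR 0 , [] , f₀ , refl , [] , refl , f₀∈DNR
    stage-invariant g∈DNR (suc n) = advance-invariant g∈DNR _ (stage-invariant g∈DNR n)

    limit∈▼ : ∀ {g} → g ∈ DNR (k ^ 2) → limit g ∈ (D ▼ D)
    limit∈▼ {g} g∈DNR n =
      let σ∈T , blocks , f , flat , leaves , values , f∈DNR = stage-invariant g∈DNR n
      in blocks , follow g (proj₂ (stage g n)) , subst (_∈ T D) (sym values) (initial f∈DNR _) , leaves , σ∈T ,
         subst (λ out → applyUpTo (limit g) n ⊑ out ++ follow g (proj₂ (stage g n))) (sym flat) (limit-prefix g n)

    ▼≤DNR : (D ▼ D) ≤¹₁ DNR (k ^ 2)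
    ▼≤DNR = code limitᶠ , λ g g∈DNR → limit g , halts limitᶠ g , limit∈▼ g∈DNR

theorem71 : ExcludedMiddle 0ℓ →
    (k : ℕ) → 2 ≤ k →
    (D : TreeFor k (DNR k)) →
    (D ▼ D) <¹₁ DNR (k ^ 2)
theorem71 em k 2≤k D = ▼≤DNR , DNR≰▼ (k ^ 2)
  where open Classical.Tree em 2≤k D
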